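{- Let $p$ be an odd prime, let $q,w\in\mathbb{C}_p$ with $|1-q|_p<1$ and $|1-w|_p<1$, and let $r\geq 1$ be an integer. Let $E_{n,w,q}^{(r)}$ be the $w$-$q$-Euler numbers of order $r$ and $G_{n,w,q}^{(r)}$ the $w$-$q$-Genocchi numbers of order $r$ (both defined in the context). Then for every integer $n\geq 0$, $$\frac{G_{n+r,w,q}^{(r)}}{r!\binom{n+r}{r}}=\int_{\mathbb{Z}_p}\cdots\int_{\mathbb{Z}_p}q^{ -(x_1+\cdots+x_r)}w^{x_1+\cdots+x_r}[x_1+\cdots+x_r]_q^n\,d\mu_{ -q}(x_1)\cdots d\mu_{ -q}(x_r)=E_{n,w,q}^{(r)},$$ and $$G_{0,w,q}^{(r)}=G_{1,w,q}^{(r)}=\cdots=G_{r-1,w,q}^{(r)}=0.$$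
   Context: $\mathbb{C}_p$ is the completion of an algebraic closure of $\mathbb{Q}_p$, with absolute value normalized by $|p|_p=1/p$. For $u\in\mathbb{C}_p$ with $|1-u|_p<1$ and $x\in\mathbb{Z}_p$, $u^x=\sum_{k\ge 0}\binom{x}{k}(u-1)^k$. Notation: $[x]_q=\frac{1-q^x}{1-q}$ (with $[x]_1=x$). For a uniformly differentiable function $f:\mathbb{Z}_p\to\mathbb{C}_p$ (the difference quotient $\frac{f(x)-f(y)}{x-y}$ has a limit as $(x,y)\to(a,a)$ for every $a\in\mathbb{Z}_p$), the invariant $p$-adic $q$-integral is $$\int_{\mathbb{Z}_p}f(x)\,d\mu_{ -q}(x)=\lim_{N\to\infty}\frac{1+q}{1+q^{p^N}}\sum_{x=0}^{p^N-1}f(x)(-q)^x.$$ Multiple integrals are iterated ($r$-fold). The $w$-$q$-Euler numbers of order $r$ are defined, for $n\ge 0$, by $$E_{n,w,q}^{(r)}=\int_{\mathbb{Z}_p}\cdots\int_{\mathbb{Z}_p}w^{x_1+\cdots+x_r}[x_1+\cdots+x_r]_q^n\,q^{ -(x_1+\cdots+x_r)}\,d\mu_{ -q}(x_1)\cdots d\mu_{ -q}(x_r).$$ The $w$-$q$-Genocchi numbers of order $r$ are defined by the following identity of formal power series in $t$ (the exponential is expanded in powers of $t$ and integrated coefficientwise): $$\sum_{n=0}^{\infty}G_{n,w,q}^{(r)}\frac{t^n}{n!}=t^r\int_{\mathbb{Z}_p}\cdots\int_{\mathbb{Z}_p}q^{ -(x_1+\cdots+x_r)}w^{x_1+\cdots+x_r}e^{[x_1+\cdots+x_r]_qt}\,d\mu_{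 -q}(x_1)\cdots d\mu_{ -q}(x_r).$$ -}

module Defs where

open import Algebra.Bundles using (CommutativeRing)
open import Data.Fin.Base using (Fin; toℕ)
open import Data.Integer.Base as ℤ using (ℤ; -[1+_])
open import Data.Nat.Base as ℕ using (ℕ; zero; suc; NonZero; _!)
open import Data.Product.Base using (∃; _×_; _,_)
open import Data.Rational.Base as ℚ using (ℚ; 0ℚ)
open import Data.Vec.Base using (Vec; []; _∷_)
open import Function.Bundles using (_⇔_; module Equivalence)
open import Level using (_⊔_) renaming (suc to lsuc)
open import Relation.Binary.PropositionalEquality.Core as ≡ using (_≡_)
open import Relation.Nullary.Construct.Add.Infimum using (_₋; ⊥₋; [_])
import Algebra.Properties.Monoid.Mult
import Algebra.Properties.Semiring.Exp
import Algebra.Properties.Semiring.Sum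
import Relation.Binary.Construct.Add.Infimum.NonStrict as NonStrict
import Relation.Binary.Construct.Add.Infimum.Strict as Strict

-- The absolute value of ℂₚ takes its values in {0} ∪ { pˢ | s ∈ ℚ }.  The real
-- number pˢ is represented by its exponent s, so that the order of the values
-- is the order of the exponents (p > 1), and 0 by a new least element.

AbsVal : Set
AbsVal = ℚ ₋

pattern 𝟎    = ⊥₋
pattern p^_ s = [ s ]

𝟏 : AbsVal
𝟏 = p^ 0ℚ

open NonStrict ℚ._≤_ public using () renaming (_≤₋_ to _≤ᵛ_)
open Strict ℚ._<_ public using () renaming (_<₋_ to _<ᵛ_)

infixl 7 _*ᵛ_
_*ᵛ_ : AbsVal → AbsVal → AbsVal
𝟎      *ᵛ _      = 𝟎
(p^ _) *ᵛ 𝟎      = 𝟎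
(p^ s) *ᵛ (p^ t) = p^ (s ℚ.+ t)

-- A field with a non-archimedean absolute value normalised by |p| = 1/p.
-- Inversion is total, with the convention 0⁻¹ = 0.

record ValuedField (p : ℕ) c ℓ : Set (lsuc (c ⊔ ℓ)) where
  infix 8 _⁻¹
  field
    commutativeRing : CommutativeRing c ℓ

  open CommutativeRing commutativeRing public
  open Algebra.Properties.Semiring.Exp semiring public using (_^_)
  open Algebra.Properties.Semiring.Sum semiring public using (sum)
  open Algebra.Properties.Monoid.Mult +-monoid public using ()
    renaming (_×_ to _·ℕ_)

  ι : ℕ → Carrier
  ι n = n ·ℕ 1#

  field
    1≉0        : 1# ≉ 0#
    _⁻¹        : Carrier → Carrier
    ⁻¹-cong    : ∀ {x y} → x ≈ y → x ⁻¹ ≈ y ⁻¹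
    ⁻¹-inverse : ∀ {x} → x ≉ 0# → x * x ⁻¹ ≈ 1#
    0⁻¹≈0      : 0# ⁻¹ ≈ 0#

    ∣_∣        : Carrier → AbsVal
    ∣∣-cong    : ∀ {x y} → x ≈ y → ∣ x ∣ ≡ ∣ y ∣
    ∣∣-zero    : ∀ {x} → ∣ x ∣ ≡ 𝟎 ⇔ x ≈ 0#
    ∣∣-*       : ∀ x y → ∣ x * y ∣ ≡ ∣ x ∣ *ᵛ ∣ y ∣
    ∣∣-+       : ∀ {x y b} → ∣ x ∣ ≤ᵛ b → ∣ y ∣ ≤ᵛ b → ∣ x + y ∣ ≤ᵛ b
    ∣p∣        : ∣ ι p ∣ ≡ p^ (ℚ.- ℚ.1ℚ)

  ιℤ : ℤ → Carrier
  ιℤ (ℤ.+ n)  = ι n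
  ιℤ -[1+ n ] = - ι (suc n)

  ιℚ : ℤ → ℕ → Carrier
  ιℚ a b = ιℤ a * ι b ⁻¹

  -- An arbitrary ε > 0 is replaced by an arbitrary power pˢ.

  _⟶_ : (ℕ → Carrier) → Carrier → Set
  a ⟶ L = ∀ s → ∃ λ N → ∀ n → N ℕ.≤ n → ∣ a n - L ∣ ≤ᵛ p^ s

  Cauchy : (ℕ → Carrier) → Set
  Cauchy a = ∀ s → ∃ λ N → ∀ m n → N ℕ.≤ m → N ℕ.≤ n → ∣ a m - a n ∣ ≤ᵛ p^ s

  -- ℤₚ and ℚₚ are realised as the closures of ℤ and ℚ.

  _∈ℤₚ _∈ℚₚ : Carrier → Set
  x ∈ℤₚ = ∀ s → ∃ λ a → ∣ x - ιℤ a ∣ ≤ᵛ p^ s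
  x ∈ℚₚ = ∀ s → ∃ λ a → ∃ λ b → NonZero b × ∣ x - ιℚ a b ∣ ≤ᵛ p^ s

  record ℤₚ : Set c where
    constructor mkℤₚ
    field
      val  : Carrier
      val∈ : val ∈ℤₚ

  open ℤₚ public

  ι∈ℤₚ : ∀ n → ι n ∈ℤₚ
  ι∈ℤₚ n s = ℤ.+ n , ≡.subst (_≤ᵛ p^ s) (≡.sym ∣x-x∣≡0) (NonStrict.⊥₋≤ _)
    where
    ∣x-x∣≡0 : ∣ ι n - ι n ∣ ≡ 𝟎
    ∣x-x∣≡0 = Equivalence.from ∣∣-zero (-‿inverseʳ (ι n))

  ℕ→ℤₚ : ℕ → ℤₚ
  ℕ→ℤₚ n = mkℤₚ (ι n) (ι∈ℤₚ n)

  -- The value at z of the monic polynomial Xᵈ + Σ_{i<d} aᵢ Xⁱ.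

  monic : ∀ {d} → (Fin d → Carrier) → Carrier → Carrier
  monic {d} a z = z ^ d + sum (λ i → a i * z ^ toℕ i)

  Algebraic : Carrier → Set (c ⊔ ℓ)
  Algebraic z = ∃ λ d → ∃ λ (a : Fin d → Carrier) → (∀ i → a i ∈ℚₚ) × monic a z ≈ 0#

-- "K is a completion of an algebraic closure of ℚₚ": K is complete, and the
-- elements of K that are algebraic over ℚₚ form an algebraically closed dense
-- subfield.  This determines K up to isomorphism.

record ComplexPAdics (p : ℕ) c ℓ : Set (lsuc (c ⊔ ℓ)) where
  field
    valuedField : ValuedField p c ℓ

  open ValuedField valuedField public

  field
    complete            : ∀ a → Cauchy a → ∃ λ L → a ⟶ L
    algebraicallyClosed : ∀ {d} (a : Fin (suc d) → Carrier) → (∀ i → Algebraic (a i)) →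
                          ∃ λ z → Algebraic z × monic a z ≈ 0#
    dense               : ∀ x s → ∃ λ z → Algebraic z × ∣ x - z ∣ ≤ᵛ p^ s

-- Values that are only defined as limits are described by functional
-- relations: "Is… args y" reads "… args exists and is equal to y".

module Integration {p c ℓ} (ℂₚ : ComplexPAdics p c ℓ) where
  open ComplexPAdics ℂₚ

  falling : Carrier → ℕ → Carrier
  falling x zero    = 1#
  falling x (suc k) = falling x k * (x - ι k)

  binomial : Carrier → ℕ → Carrier
  binomial x k = falling x k * ι (k !) ⁻¹

  -- y = uˣ

  IsPower : (u x y : Carrier) → Set
  IsPower u x y = (λ N → sum {N} λ k → binomial x (toℕ k) * (u - 1#) ^ toℕ k) ⟶ y

  -- y = [x]_q

  data IsBracket (q x y : Carrier) : Set (c ⊔ ℓ) where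
    q≈1 : q ≈ 1# → y ≈ x → IsBracket q x y
    q≉1 : ∀ {qˣ} → q ≉ 1# → IsPower q x qˣ → y ≈ (1# - qˣ) * (1# - q) ⁻¹ →
          IsBracket q x y

  HasDifferenceQuotientLimit : (ℤₚ → Carrier) → ℤₚ → Carrier → Set (c ⊔ ℓ)
  HasDifferenceQuotientLimit f a f′a =
    ∀ s → ∃ λ t → ∀ x y → val x ≉ val y →
    ∣ val x - val a ∣ ≤ᵛ p^ t → ∣ val y - val a ∣ ≤ᵛ p^ t →
    ∣ (f x - f y) * (val x - val y) ⁻¹ - f′a ∣ ≤ᵛ p^ s

  UniformlyDifferentiable : (ℤₚ → Carrier) → Set (c ⊔ ℓ)
  UniformlyDifferentiable f = ∀ a → ∃ λ f′a → HasDifferenceQuotientLimit f a f′a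

  riemannSum : Carrier → (ℤₚ → Carrier) → ℕ → Carrier
  riemannSum q f N = (1# + q) * (1# + q ^ (p ℕ.^ N)) ⁻¹ *
                     sum {p ℕ.^ N} λ x → f (ℕ→ℤₚ (toℕ x)) * (- q) ^ toℕ x

  -- I = ∫ f dμ₋q

  record IsIntegral (q : Carrier) (f : ℤₚ → Carrier) (I : Carrier) : Set (c ⊔ ℓ) where
    field
      f-cong                  : ∀ {x y} → val x ≈ val y → f x ≈ f y
      uniformlyDifferentiable : UniformlyDifferentiable f
      limit                   : riemannSum q f ⟶ I

  -- I is the r-fold iterated integral of the function F, given by its graph:
  -- "F xs y" reads "F(xs) = y".  The first variable is the outermost one.

  IsIteratedIntegral : Carrier → (r : ℕ) → (Vec ℤₚ r → Carrier → Set (c ⊔ ℓ)) →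
                       Carrier → Set (c ⊔ ℓ)
  IsIteratedIntegral q zero    F I = F [] I
  IsIteratedIntegral q (suc r) F I = ∃ λ (g : ℤₚ → Carrier) →
    (∀ x → IsIteratedIntegral q r (λ xs → F (x ∷ xs)) (g x)) × IsIntegral q g I

  total : ∀ {r} → Vec ℤₚ r → Carrier
  total []       = 0#
  total (x ∷ xs) = val x + total xs

  -- The graph of xs ↦ h (q^{-s}) (w^s) [s]_q where s = x₁ + ⋯ + x_r.

  Integrand : (q w : Carrier) → (Carrier → Carrier → Carrier → Carrier) →
              ∀ {r} → Vec ℤₚ r → Carrier → Set (c ⊔ ℓ)
  Integrand q w h xs y = ∃ λ q⁻ˢ → ∃ λ wˢ → ∃ λ [s] →
    IsPower q (- total xs) q⁻ˢ × IsPower w (total xs) wˢ ×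
    IsBracket q (total xs) [s] × y ≈ h q⁻ˢ wˢ [s]

  -- Formal power series in t, given by their coefficients.

  Series : Set c
  Series = ℕ → Carrier

  egf : (ℕ → Carrier) → Series
  egf a n = a n * ι (n !) ⁻¹

  exp[_t] : Carrier → Series
  exp[ a t] = egf (a ^_)

  t^_·_ : ℕ → Series → Series
  (t^ zero  · S) n       = S n
  (t^ suc r · S) zero    = 0#
  (t^ suc r · S) (suc n) = (t^ r · S) n

  IsEulerNumbers : (q w : Carrier) → ℕ → (ℕ → Carrier) → Set (c ⊔ ℓ)
  IsEulerNumbers q w r E = ∀ n →
    IsIteratedIntegral q r (Integrand q w λ q⁻ˢ wˢ [s] → wˢ * [s] ^ n * q⁻ˢ) (E n)

  IsGenocchiNumbers : (q w : Carrier) → ℕ → (ℕ → Carrier) → Set (c ⊔ ℓ)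
  IsGenocchiNumbers q w r G = ∃ λ (S : Series) →
    (∀ n → IsIteratedIntegral q r
             (Integrand q w λ q⁻ˢ wˢ [s] → q⁻ˢ * wˢ * exp[ [s] t] n) (S n)) ×
    (∀ n → egf G n ≈ (t^ r · S) n)

{-# OPTIONS --safe #-}
module Submission where

open import Defs
open import Data.Nat.Base as ℕ using (ℕ; zero; suc; NonZero; _!)
open import Data.Nat.Combinatorics using (_C_; nCk≡n!/k![n-k]!; k![n∸k]!∣n!)
open import Data.Nat.Divisibility using (_∣_; divides; _∣?_; ∣⇒≤)
open import Data.Nat.Primality using (Prime; prime⇒irreducible; prime⇒nonTrivial; prime⇒nonZero)
open import Data.Product.Base using (∃; _×_; _,_; proj₁; proj₂)
open import Relation.Nullary.Negation using (¬_; contradiction)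

open import Algebra.Bundles using (CommutativeRing; RawRing)
open import Algebra.Solver.Ring.AlmostCommutativeRing using (fromCommutativeRing; _-Raw-AlmostCommutative⟶_)
open import Data.Fin.Base using (toℕ)
open import Data.Integer.Base as ℤ using (ℤ; -[1+_])
import Data.Integer.Properties as ℤ
open import Data.Maybe.Base using (Maybe; just; nothing)
open import Data.Nat.Coprimality using (Coprime; coprime-Bézout)
import Data.Nat.DivMod as ℕ
open import Data.Nat.GCD using (module Bézout)
open import Data.Nat.Induction using (<-rec)
import Data.Nat.Properties as ℕ
open import Data.Rational.Base as ℚ using (ℚ; 0ℚ; 1ℚ; mkℚ; toℚᵘ)
import Data.Rational.Properties as ℚ
open import Data.Rational.Unnormalised.Base as ℚᵘ using (mkℚᵘ; *≡*; *≤*)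
import Data.Rational.Unnormalised.Properties as ℚᵘ
open import Data.Sum.Base using (_⊎_; inj₁; inj₂)
open import Data.Vec.Base using (Vec; []; _∷_)
open import Function.Base using (_∘_)
open import Function.Bundles using (module Equivalence)
open import Level using (_⊔_)
open import Relation.Binary.Definitions using (tri<; tri≈; tri>)
open import Relation.Binary.PropositionalEquality as ≡ using (_≡_)
open import Relation.Nullary.Decidable using (Dec; yes; no)
import Algebra.Properties.Group
import Algebra.Properties.Monoid.Mult
import Algebra.Properties.Ring
import Algebra.Properties.Semiring.Exp
import Algebra.Properties.Semiring.Mult
import Algebra.Properties.Semiring.Mult.TCOptimised
import Algebra.Properties.Semiring.Sum
import Algebra.Solver.Ring
import Relation.Binary.Construct.Add.Infimum.NonStrict as NonStrict
import Relation.Binary.Construct.Add.Infimum.Strict as Strict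

-- The integrands lie in the class 𝒟 of bounded Lipschitz functions f on ℤₚ with
--   |f(x) - f(y) - f(z) + f(w)| ≤ C |x - y| |x - z|   whenever x - y = z - w.
-- The class contains constants, the identity and x ↦ uˣ (for which the left side
-- is |u^w| |u^h - 1| |u^k - 1|), and it is closed under differences, products and
-- translations.  For f ∈ 𝒟 the quotients (f(a + pᴺ) - f(a)) / pᴺ converge to a
-- derivative with error O(p⁻ᴺ), and consecutive Riemann sums differ by O(p⁻ᴺ).
-- As the defining estimates pass to limits, c ↦ ∫ f(c + x) dμ₋q(x) is again in 𝒟,
-- so the integration can be iterated.  The identities then follow by comparing
-- the coefficients of tⁿ⁺ʳ, from uniqueness and homogeneity of the integral.

-- The coefficient n - m is represented by the pair (n , m).  The interpretation
-- cancels common successors, so that equal coefficients become identical terms.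

-- The difficulty lies in existence: each inner integral must again be uniformly differentiable in
-- the outer variable, and a pointwise limit does not inherit this from bare differentiability,
-- whereas estimates with a fixed constant survive. The Lipschitz bound alone makes Riemann sums
-- converge; the second-difference bound serves the derivative, because it makes f(a + mk) - f(a)
-- equal to m (f(a + k) - f(a)) up to O(|k|²). The integrands depend only on x₁ + ⋯ + x_r, so an
-- inner integral is a function of the sum of the outer variables, and functions of one variable
-- suffice throughout. Oddness of p enters twice: 2 is a unit, so 1 + qⁿ is one too, and (-q)^(pᴺ) =
-- -q^(pᴺ). The linear bound |uʰ - 1| ≤ C |h| is not read off the binomial series, where the bounds
-- for single terms involve 1/k!, but comes from the way u^(pᴺ) - 1 shrinks under p-th powers.

module IntegerSolver {c ℓ} (R : CommutativeRing c ℓ) where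
  open CommutativeRing R
  open Algebra.Properties.Semiring.Mult.TCOptimised semiring
    renaming (_×_ to _·_; ×-homo-+ to ·-homo-+; ×1-homo-* to ·1-homo-*)
  open Algebra.Properties.Ring ring
  open import Relation.Binary.Reasoning.Setoid setoid

  private
    Difference : RawRing _ _
    Difference = record
      { Carrier = ℕ × ℕ
      ; _≈_ = _≡_
      ; _+_ = λ (a , b) (c , d) → a ℕ.+ c , b ℕ.+ d
      ; _*_ = λ (a , b) (c , d) → a ℕ.* c ℕ.+ b ℕ.* d , a ℕ.* d ℕ.+ b ℕ.* c
      ; -_ = λ (a , b) → b , a
      ; 0# = 0 , 0
      ; 1# = 1 , 0
      }

    ⟪_⟫ : ℕ × ℕ → Carrier
    ⟪ n     , zero ⟫  = n · 1#
    ⟪ zero  , suc m ⟫ = - (suc m · 1#)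
    ⟪ suc n , suc m ⟫ = ⟪ n , m ⟫

    +-swap : ∀ a b c d → (a + b) + (c + d) ≈ (a + c) + (b + d)
    +-swap a b c d = begin
      (a + b) + (c + d) ≈⟨ +-assoc a b (c + d) ⟩
      a + (b + (c + d)) ≈⟨ +-congˡ (+-assoc b c d) ⟨
      a + ((b + c) + d) ≈⟨ +-congˡ (+-congʳ (+-comm b c)) ⟩
      a + ((c + b) + d) ≈⟨ +-congˡ (+-assoc c b d) ⟩
      a + (c + (b + d)) ≈⟨ +-assoc a c (b + d) ⟨
      (a + c) + (b + d) ∎

    -‿+ : ∀ a b → - (a + b) ≈ - a + - b
    -‿+ a b = sym (-‿+-comm a b)

    diff-+ : ∀ a b c d → (a + c) - (b + d) ≈ (a - b) + (c - d)
    diff-+ a b c d = trans (+-congˡ (-‿+ b d)) (+-swap a c (- b) (- d))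

    ⟪⟫≈ : ∀ n m → ⟪ n , m ⟫ ≈ n · 1# - m · 1#
    ⟪⟫≈ n       zero    = sym (trans (+-congˡ -0#≈0#) (+-identityʳ _))
    ⟪⟫≈ zero    (suc m) = sym (+-identityˡ _)
    ⟪⟫≈ (suc n) (suc m) = sym (begin
      suc n · 1# - suc m · 1#                  ≈⟨ +-cong (·-homo-+ 1# 1 n) (-‿cong (·-homo-+ 1# 1 m)) ⟩
      (1# + n · 1#) - (1# + m · 1#)            ≈⟨ diff-+ 1# 1# (n · 1#) (m · 1#) ⟩
      (1# - 1#) + (n · 1# - m · 1#)            ≈⟨ +-congʳ (-‿inverseʳ 1#) ⟩
      0# + (n · 1# - m · 1#)                   ≈⟨ +-identityˡ _ ⟩
      n · 1# - m · 1#                          ≈⟨ ⟪⟫≈ n m ⟨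
      ⟪ n , m ⟫                                ∎)

    diff-* : ∀ a b c d → (a * c + b * d) - (a * d + b * c) ≈ (a - b) * (c - d)
    diff-* a b c d = sym (begin
      (a - b) * (c - d)                             ≈⟨ distribʳ (c - d) a (- b) ⟩
      a * (c - d) + - b * (c - d)                   ≈⟨ +-cong (distribˡ a c (- d)) (distribˡ (- b) c (- d)) ⟩
      (a * c + a * - d) + (- b * c + - b * - d)     ≈⟨ +-cong (+-congˡ (sym (-‿distribʳ-* a d))) (+-comm _ _) ⟩
      (a * c - a * d) + (- b * - d + - b * c)       ≈⟨ +-congˡ (+-cong -b*-d (sym (-‿distribˡ-* b c))) ⟩
      (a * c - a * d) + (b * d - b * c)             ≈⟨ diff-+ (a * c) (a * d) (b * d) (b * c) ⟨
      (a * c + b * d) - (a * d + b * c)             ∎)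
      where
      -b*-d : - b * - d ≈ b * d
      -b*-d = trans (sym (-‿distribˡ-* b (- d))) (trans (-‿cong (sym (-‿distribʳ-* b d))) (-‿involutive _))

    diff-neg : ∀ a b → b - a ≈ - (a - b)
    diff-neg a b = sym (trans (-‿+ a (- b)) (trans (+-congˡ (-‿involutive b)) (+-comm _ _)))

    homo* : ∀ a b c d → (a ℕ.* c ℕ.+ b ℕ.* d) · 1# ≈ a · 1# * c · 1# + b · 1# * d · 1#
    homo* a b c d = trans (·-homo-+ 1# (a ℕ.* c) (b ℕ.* d)) (+-cong (·1-homo-* a c) (·1-homo-* b d))

    morphism : Difference -Raw-AlmostCommutative⟶ fromCommutativeRing R
    morphism = record
      { ⟦_⟧    = ⟪_⟫
      ; +-homo = λ (a , b) (c , d) → begin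
          ⟪ a ℕ.+ c , b ℕ.+ d ⟫                      ≈⟨ ⟪⟫≈ (a ℕ.+ c) (b ℕ.+ d) ⟩
          (a ℕ.+ c) · 1# - (b ℕ.+ d) · 1#            ≈⟨ +-cong (·-homo-+ 1# a c) (-‿cong (·-homo-+ 1# b d)) ⟩
          (a · 1# + c · 1#) - (b · 1# + d · 1#)      ≈⟨ diff-+ _ _ _ _ ⟩
          (a · 1# - b · 1#) + (c · 1# - d · 1#)      ≈⟨ +-cong (⟪⟫≈ a b) (⟪⟫≈ c d) ⟨
          ⟪ a , b ⟫ + ⟪ c , d ⟫                      ∎
      ; *-homo = λ (a , b) (c , d) → begin
          ⟪ a ℕ.* c ℕ.+ b ℕ.* d , a ℕ.* d ℕ.+ b ℕ.* c ⟫ ≈⟨ ⟪⟫≈ (a ℕ.* c ℕ.+ b ℕ.* d) (a ℕ.* d ℕ.+ b ℕ.* c) ⟩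
          _                                          ≈⟨ +-cong (homo* a b c d) (-‿cong (homo* a b d c)) ⟩
          _                                          ≈⟨ diff-* _ _ _ _ ⟩
          (a · 1# - b · 1#) * (c · 1# - d · 1#)      ≈⟨ *-cong (⟪⟫≈ a b) (⟪⟫≈ c d) ⟨
          ⟪ a , b ⟫ * ⟪ c , d ⟫                      ∎
      ; -‿homo = λ (a , b) → trans (⟪⟫≈ b a) (trans (diff-neg _ _) (-‿cong (sym (⟪⟫≈ a b))))
      ; 0-homo = refl
      ; 1-homo = refl
      }

    _≟_ : ∀ x y → Maybe (⟪ x ⟫ ≈ ⟪ y ⟫)
    (a , b) ≟ (c , d) with a ℕ.+ d ℕ.≟ b ℕ.+ c
    ... | no _  = nothing
    ... | yes e = just (trans (⟪⟫≈ a b) (trans (x-y≈z-w eq) (sym (⟪⟫≈ c d))))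
      where
      eq : a · 1# + d · 1# ≈ b · 1# + c · 1#
      eq = trans (sym (·-homo-+ 1# a d)) (trans (reflexive (≡.cong (_· 1#) e)) (·-homo-+ 1# b c))

      x-y≈z-w : ∀ {x y z w} → x + w ≈ y + z → x - y ≈ z - w
      x-y≈z-w {x} {y} {z} {w} h = begin
        x - y                 ≈⟨ +-identityʳ _ ⟨
        (x - y) + 0#          ≈⟨ +-congˡ (-‿inverseʳ w) ⟨
        (x - y) + (w - w)     ≈⟨ diff-+ x y w w ⟨
        (x + w) - (y + w)     ≈⟨ +-congʳ (trans h (+-comm y z)) ⟩
        (z + y) - (y + w)     ≈⟨ +-congˡ (-‿cong (+-comm y w)) ⟩
        (z + y) - (w + y)     ≈⟨ diff-+ z w y y ⟩
        (z - w) + (y - y)     ≈⟨ +-congˡ (-‿inverseʳ y) ⟩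
        (z - w) + 0#          ≈⟨ +-identityʳ _ ⟩
        z - w                 ∎

  open Algebra.Solver.Ring Difference (fromCommutativeRing R) morphism _≟_ public
    using (solve; _:=_; _:+_; _:*_; _:-_; :-_; con)

  :1 : ∀ {n} → Algebra.Solver.Ring.Polynomial Difference (fromCommutativeRing R) morphism _≟_ n
  :1 = con (1 , 0)

-- Rational exponents: multiples, signs and the Archimedean property.

module ℚ-Solver = IntegerSolver ℚ.+-*-commutativeRing

open Algebra.Properties.Monoid.Mult ℚ.+-0-monoid using () renaming (_×_ to _·ℚ_; ×-homo-+ to ·ℚ-homo-+)

module ≤ᵛ = NonStrict ℚ._≤_
module <ᵛ = Strict ℚ._<_

-- Sums in `ℚ` are reduced to lowest terms, which hides the numerator of a multiple. Unnormalised,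
-- the multiple has numerator n e over the old denominator, and the Archimedean property becomes an
-- inequality of integers.
toℚᵘ-· : ∀ n e d .(c : Coprime ℤ.∣ e ∣ (suc d)) → toℚᵘ (n ·ℚ mkℚ e d c) ℚᵘ.≃ mkℚᵘ (ℤ.+ n ℤ.* e) d
toℚᵘ-· zero e d c = *≡* ≡.refl
toℚᵘ-· (suc n) e d c = begin
  toℚᵘ (mkℚ e d c ℚ.+ n ·ℚ mkℚ e d c)                   ≈⟨ ℚ.toℚᵘ-homo-+ (mkℚ e d c) (n ·ℚ mkℚ e d c) ⟩
  mkℚᵘ e d ℚᵘ.+ toℚᵘ (n ·ℚ mkℚ e d c)                   ≈⟨ ℚᵘ.+-congʳ (mkℚᵘ e d) (toℚᵘ-· n e d c) ⟩
  mkℚᵘ e d ℚᵘ.+ mkℚᵘ (ℤ.+ n ℤ.* e) d                    ≈⟨ *≡* (lemma e (ℤ.+ suc d) (ℤ.+ n)) ⟩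
  mkℚᵘ (ℤ.+ suc n ℤ.* e) d                              ∎
  where
  open ℚᵘ.≃-Reasoning
  lemma : ∀ e D n → (e ℤ.* D ℤ.+ n ℤ.* e ℤ.* D) ℤ.* D ≡ (ℤ.+ 1 ℤ.+ n) ℤ.* e ℤ.* (D ℤ.* D)
  lemma = solve 3 (λ e D n → (e :* D :+ n :* e :* D) :* D := (:1 :+ n) :* e :* (D :* D)) ≡.refl
    where open IntegerSolver ℤ.+-*-commutativeRing

archimedean : ∀ {ε} → 0ℚ ℚ.< ε → ∀ r → ∃ λ N → r ℚ.≤ N ·ℚ ε
archimedean {mkℚ (ℤ.+ suc e) d c} _ (mkℚ a b c′) = N ,
  ℚ.toℚᵘ-cancel-≤ (ℚᵘ.≤-respʳ-≃ (ℚᵘ.≃-sym (toℚᵘ-· N (ℤ.+ suc e) d c)) (*≤* bound))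
  where
  N : ℕ
  -- With ε = (e + 1)/(d + 1) this gives N ε = |a| (e + 1), which is at least a/(b + 1).
  N = ℤ.∣ a ∣ ℕ.* suc d

  bound : a ℤ.* ℤ.+ suc d ℤ.≤ ℤ.+ N ℤ.* ℤ.+ suc e ℤ.* ℤ.+ suc b
  bound = begin
    a ℤ.* ℤ.+ suc d                        ≤⟨ ℤ.*-monoʳ-≤-nonNeg (ℤ.+ suc d) (a≤∣a∣ a) ⟩
    ℤ.+ ℤ.∣ a ∣ ℤ.* ℤ.+ suc d              ≡⟨ ℤ.pos-* ℤ.∣ a ∣ (suc d) ⟨
    ℤ.+ N                                  ≤⟨ ℤ.+≤+ (ℕ.≤-trans (ℕ.m≤m*n N (suc e)) (ℕ.m≤m*n _ (suc b))) ⟩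
    ℤ.+ (N ℕ.* suc e ℕ.* suc b)            ≡⟨ ℤ.pos-* (N ℕ.* suc e) (suc b) ⟩
    ℤ.+ (N ℕ.* suc e) ℤ.* ℤ.+ suc b        ≡⟨ ≡.cong (ℤ._* ℤ.+ suc b) (ℤ.pos-* N (suc e)) ⟩
    ℤ.+ N ℤ.* ℤ.+ suc e ℤ.* ℤ.+ suc b      ∎
    where
    open ℤ.≤-Reasoning
    a≤∣a∣ : ∀ a → a ℤ.≤ ℤ.+ ℤ.∣ a ∣
    a≤∣a∣ (ℤ.+ n)  = ℤ.≤-refl
    a≤∣a∣ -[1+ n ] = ℤ.-≤+
archimedean {mkℚ (ℤ.+ zero) d c} (ℚ.*<* (ℤ.+<+ ())) _
archimedean {mkℚ -[1+ e ] d c} (ℚ.*<* ()) _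

<⇒≱ : ∀ {s t} → s ℚ.< t → ¬ t ℚ.≤ s
<⇒≱ s<t t≤s = ℚ.<-irrefl ≡.refl (ℚ.<-≤-trans s<t t≤s)

-1ℚ : ℚ
-1ℚ = ℚ.- 1ℚ

-1<0 : -1ℚ ℚ.< 0ℚ
-1<0 = ℚ.*<* ℤ.-<+

0≤1 : 0ℚ ℚ.≤ 1ℚ
0≤1 = ℚ.*≤* (ℤ.+≤+ ℕ.z≤n)

neg-· : ∀ n ε → n ·ℚ (ℚ.- ε) ≡ ℚ.- (n ·ℚ ε)
neg-· zero ε = ≡.refl
neg-· (suc n) ε = ≡.trans (≡.cong (ℚ.- ε ℚ.+_) (neg-· n ε)) (≡.sym (ℚ.neg-distrib-+ ε (n ·ℚ ε)))

·ℚ-nonPos : ∀ n {δ} → δ ℚ.≤ 0ℚ → n ·ℚ δ ℚ.≤ 0ℚ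
·ℚ-nonPos zero    δ≤0 = ℚ.≤-refl
·ℚ-nonPos (suc n) δ≤0 = ℚ.+-mono-≤ δ≤0 (·ℚ-nonPos n δ≤0)

·ℚ-anti : ∀ {m n δ} → δ ℚ.≤ 0ℚ → m ℕ.≤ n → n ·ℚ δ ℚ.≤ m ·ℚ δ
·ℚ-anti {n = n} δ≤0 ℕ.z≤n = ·ℚ-nonPos n δ≤0
·ℚ-anti {δ = δ} δ≤0 (ℕ.s≤s m≤n) = ℚ.+-monoʳ-≤ δ (·ℚ-anti δ≤0 m≤n)

abstract
  ·ℚ→-∞ : ∀ {δ} → δ ℚ.< 0ℚ → ∀ s → ∃ λ N → ∀ n → N ℕ.≤ n → n ·ℚ δ ℚ.≤ s
  ·ℚ→-∞ {δ} δ<0 s with archimedean (ℚ.neg-antimono-< δ<0) (ℚ.- s)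
  ... | N , h = N , λ n N≤n → begin
    n ·ℚ δ                      ≤⟨ ·ℚ-anti (ℚ.<⇒≤ δ<0) N≤n ⟩
    N ·ℚ δ                      ≡⟨ ≡.cong (N ·ℚ_) (neg-neg δ) ⟨
    N ·ℚ (ℚ.- (ℚ.- δ))          ≡⟨ neg-· N (ℚ.- δ) ⟩
    ℚ.- (N ·ℚ (ℚ.- δ))          ≤⟨ ℚ.neg-antimono-≤ h ⟩
    ℚ.- (ℚ.- s)                 ≡⟨ neg-neg s ⟩
    s                           ∎
    where
    open ℚ.≤-Reasoning
    neg-neg : ∀ x → ℚ.- (ℚ.- x) ≡ x
    neg-neg = Algebra.Properties.Group.⁻¹-involutive ℚ.+-0-group

-- Closed balls, units, and absolute values of natural numbers.

module Balls {p c ℓ} (prime : Prime p) (V : ValuedField p c ℓ) where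
  open ValuedField V
  open Algebra.Properties.Ring ring
  open Algebra.Properties.Semiring.Mult semiring using (×-homo-+; ×1-homo-*)
  module K = IntegerSolver commutativeRing
  open K
  open import Relation.Binary.Reasoning.Setoid setoid

  infix 4 _∈B_
  _∈B_ : Carrier → ℚ → Set
  x ∈B s = ∣ x ∣ ≤ᵛ p^ s

  ∈B-mono : ∀ {x s t} → s ℚ.≤ t → x ∈B s → x ∈B t
  ∈B-mono s≤t x∈ = ≤ᵛ.≤₋-trans ℚ.≤-trans x∈ ≤ᵛ.[ s≤t ]

  ∈B-≡ : ∀ {x s t} → s ≡ t → x ∈B s → x ∈B t
  ∈B-≡ ≡.refl x∈ = x∈

  ∈B-≈ : ∀ {x y s} → x ≈ y → x ∈B s → y ∈B s
  ∈B-≈ {s = s} x≈y = ≡.subst (_≤ᵛ p^ s) (∣∣-cong x≈y)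

  ∣∣≡𝟎 : ∀ {x} → x ≈ 0# → ∣ x ∣ ≡ 𝟎
  ∣∣≡𝟎 = Equivalence.from ∣∣-zero

  ≈0 : ∀ {x} → ∣ x ∣ ≡ 𝟎 → x ≈ 0#
  ≈0 = Equivalence.to ∣∣-zero

  ≈0⇒∈B : ∀ {x s} → x ≈ 0# → x ∈B s
  ≈0⇒∈B {s = s} x≈0 = ≡.subst (_≤ᵛ p^ s) (≡.sym (∣∣≡𝟎 x≈0)) (≤ᵛ.⊥₋≤ _)

  ∈B-+ : ∀ {x y s} → x ∈B s → y ∈B s → x + y ∈B s
  ∈B-+ = ∣∣-+

  ∈B-* : ∀ {x y s t} → x ∈B s → y ∈B t → x * y ∈B s ℚ.+ t
  ∈B-* {x} {y} x∈ y∈ = ≡.subst (_≤ᵛ _) (≡.sym (∣∣-* x y)) (*ᵛ-mono x∈ y∈)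
    where
    *ᵛ-mono : ∀ {u v s t} → u ≤ᵛ p^ s → v ≤ᵛ p^ t → u *ᵛ v ≤ᵛ p^ (s ℚ.+ t)
    *ᵛ-mono (≤ᵛ.⊥₋≤ _) _          = ≤ᵛ.⊥₋≤ _
    *ᵛ-mono ≤ᵛ.[ _ ]   (≤ᵛ.⊥₋≤ _) = ≤ᵛ.⊥₋≤ _
    *ᵛ-mono ≤ᵛ.[ h ]   ≤ᵛ.[ k ]   = ≤ᵛ.[ ℚ.+-mono-≤ h k ]

  ∣∣? : ∀ x → x ≈ 0# ⊎ ∃ λ s → ∣ x ∣ ≡ p^ s
  ∣∣? x with ∣ x ∣ in eq
  ... | 𝟎    = inj₁ (≈0 eq)
  ... | p^ s = inj₂ (s , ≡.refl)

  -- Absolute values are data, either `𝟎` or a power of p, so a case split decides vanishing.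
  -- `bracket` relies on this to separate q = 1 from q ≠ 1.
  ≈0? : ∀ x → Dec (x ≈ 0#)
  ≈0? x with ∣∣? x
  ... | inj₁ x≈0       = yes x≈0
  ... | inj₂ (s , eq)  = no λ x≈0 → contradiction (≡.trans (≡.sym eq) (∣∣≡𝟎 x≈0)) λ ()

  ∣∣≡⇒∈B : ∀ {x s} → ∣ x ∣ ≡ p^ s → x ∈B s
  ∣∣≡⇒∈B eq = ≡.subst (_≤ᵛ _) (≡.sym eq) ≤ᵛ.[ ℚ.≤-refl ]

  ∈B⇒≤ : ∀ {x s t} → ∣ x ∣ ≡ p^ s → x ∈B t → s ℚ.≤ t
  ∈B⇒≤ eq x∈ = ≤ᵛ.[≤]-injective (≡.subst (_≤ᵛ _) eq x∈)

  bound : ∀ x → ∃ λ s → x ∈B s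
  bound x with ∣∣? x
  ... | inj₁ x≈0      = 0ℚ , ≈0⇒∈B x≈0
  ... | inj₂ (s , eq) = s , ∣∣≡⇒∈B eq

  ∀∈B⇒≈0 : ∀ {x} → (∀ s → x ∈B s) → x ≈ 0#
  ∀∈B⇒≈0 {x} h with ∣∣? x
  ... | inj₁ x≈0      = x≈0
  ... | inj₂ (s , eq) = contradiction (∈B⇒≤ eq (h (s ℚ.+ -1ℚ)))
    (<⇒≱ (≡.subst (s ℚ.+ -1ℚ ℚ.<_) (ℚ.+-identityʳ s) (ℚ.+-monoʳ-< s -1<0)))

  Unit : Carrier → Set
  Unit x = ∣ x ∣ ≡ 𝟏

  Unit⇒∈B : ∀ {x} → Unit x → x ∈B 0ℚ
  Unit⇒∈B = ∣∣≡⇒∈B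

  Unit⇒∉B : ∀ {x δ} → Unit x → δ ℚ.< 0ℚ → ¬ x ∈B δ
  Unit⇒∉B u δ<0 x∈ = <⇒≱ δ<0 (∈B⇒≤ u x∈)

  Unit⇒≉0 : ∀ {x} → Unit x → x ≉ 0#
  Unit⇒≉0 u x≈0 = Unit⇒∉B u -1<0 (≈0⇒∈B x≈0)

  unit : ∀ {x} → x ∈B 0ℚ → (∀ {δ} → δ ℚ.< 0ℚ → ¬ x ∈B δ) → Unit x
  unit {x} x∈ x∉ with ∣∣? x
  ... | inj₁ x≈0      = contradiction (≈0⇒∈B x≈0) (x∉ -1<0)
  ... | inj₂ (s , eq) with ℚ.<-cmp s 0ℚ
  ... | tri< s<0 _ _    = contradiction (∣∣≡⇒∈B eq) (x∉ s<0)
  ... | tri≈ _ ≡.refl _ = eq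
  ... | tri> _ _ s>0    = contradiction (∈B⇒≤ eq x∈) (<⇒≱ s>0)

  private
    s+s≡s⇒s≡0 : ∀ s → s ℚ.+ s ≡ s → s ≡ 0ℚ
    s+s≡s⇒s≡0 s eq = Algebra.Properties.Group.∙-cancelˡ ℚ.+-0-group s s 0ℚ
                       (≡.trans eq (≡.sym (ℚ.+-identityʳ s)))

    s+s≡0⇒s≡0 : ∀ s → s ℚ.+ s ≡ 0ℚ → s ≡ 0ℚ
    s+s≡0⇒s≡0 s eq with ℚ.<-cmp s 0ℚ
    ... | tri< s<0 _ _ = contradiction eq (ℚ.<⇒≢ (ℚ.+-mono-< s<0 s<0))
    ... | tri≈ _ s≡0 _ = s≡0
    ... | tri> _ _ s>0 = contradiction (≡.sym eq) (ℚ.<⇒≢ (ℚ.+-mono-< s>0 s>0))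

    p^-injective : ∀ {s t} → _≡_ {A = AbsVal} (p^ s) (p^ t) → s ≡ t
    p^-injective ≡.refl = ≡.refl

  -- From 1 · 1 = 1 the exponent s of |1| satisfies s + s = s; the value `𝟎` is excluded by `1≉0`.
  Unit-1 : Unit 1#
  Unit-1 with ∣∣? 1#
  ... | inj₁ 1≈0      = contradiction 1≈0 1≉0
  ... | inj₂ (s , eq) = ≡.trans eq (≡.cong p^_ (s+s≡s⇒s≡0 s (p^-injective (≡.trans
    (≡.sym (≡.trans (∣∣-* 1# 1#) (≡.cong₂ _*ᵛ_ eq eq))) (≡.trans (∣∣-cong (*-identityˡ 1#)) eq)))))

  Unit-≈ : ∀ {x y} → x ≈ y → Unit x → Unit y
  Unit-≈ x≈y u = ≡.trans (≡.sym (∣∣-cong x≈y)) u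

  Unit-√ : ∀ {x} → Unit (x * x) → Unit x
  Unit-√ {x} u with ∣∣? x
  ... | inj₁ x≈0      = contradiction (trans (*-congˡ x≈0) (zeroʳ x)) (Unit⇒≉0 u)
  ... | inj₂ (s , eq) = ≡.trans eq (≡.cong p^_ (s+s≡0⇒s≡0 s (p^-injective
    (≡.trans (≡.sym (≡.trans (∣∣-* x x) (≡.cong₂ _*ᵛ_ eq eq))) u))))

  -- (-1)² = 1, and s + s = 0 forces s = 0 in ℚ. This makes balls symmetric, see `∈B-neg`.
  Unit--1 : Unit (- 1#)
  Unit--1 = Unit-√ (Unit-≈ (solve 0 (:1 := :- :1 :* :- :1) refl) Unit-1)

  ∈B-Unit* : ∀ {x y s} → x ∈B 0ℚ → y ∈B s → x * y ∈B s
  ∈B-Unit* x∈ y∈ = ∈B-≡ (ℚ.+-identityˡ _) (∈B-* x∈ y∈)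

  ∈B-*Unit : ∀ {x y s} → x ∈B s → y ∈B 0ℚ → x * y ∈B s
  ∈B-*Unit x∈ y∈ = ∈B-≡ (ℚ.+-identityʳ _) (∈B-* x∈ y∈)

  ∈B-neg : ∀ {x s} → x ∈B s → - x ∈B s
  ∈B-neg {x} x∈ = ∈B-≈ (-1*x≈-x x) (∈B-Unit* (Unit⇒∈B Unit--1) x∈)

  ∈B-- : ∀ {x y s} → x ∈B s → y ∈B s → x - y ∈B s
  ∈B-- x∈ y∈ = ∈B-+ x∈ (∈B-neg y∈)

  x-y≈-[y-x] : ∀ x y → x - y ≈ - (y - x)
  x-y≈-[y-x] = solve 2 (λ x y → x :- y := :- (y :- x)) refl

  ∈B-swap : ∀ {x y s} → x - y ∈B s → y - x ∈B s
  ∈B-swap {x} {y} h = ∈B-≈ (sym (x-y≈-[y-x] y x)) (∈B-neg h)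

  ∈B-trans : ∀ {x y z s} → x - y ∈B s → y - z ∈B s → x - z ∈B s
  ∈B-trans {x} {y} {z} h k = ∈B-≈ (solve 3 (λ x y z → (x :- y) :+ (y :- z) := x :- z) refl x y z) (∈B-+ h k)

  x-y≈0⇒x≈y : ∀ {x y} → x - y ≈ 0# → x ≈ y
  x-y≈0⇒x≈y {x} {y} h = begin
    x           ≈⟨ solve 2 (λ x y → x := (x :- y) :+ y) refl x y ⟩
    (x - y) + y ≈⟨ +-congʳ h ⟩
    0# + y      ≈⟨ +-identityˡ y ⟩
    y           ∎

  x≈y⇒x-y≈0 : ∀ {x y} → x ≈ y → x - y ≈ 0#
  x≈y⇒x-y≈0 {x} {y} h = trans (+-congʳ h) (-‿inverseʳ y)

  ∈B⇒≈ : ∀ {x y} → (∀ s → x - y ∈B s) → x ≈ y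
  ∈B⇒≈ h = x-y≈0⇒x≈y (∀∈B⇒≈0 h)

  ≈⇒∈B : ∀ {x y s} → x ≈ y → x - y ∈B s
  ≈⇒∈B x≈y = ≈0⇒∈B (x≈y⇒x-y≈0 x≈y)

  -- The larger term dominates: if x + y lay in a ball of negative exponent, then so would x = (x +
  -- y) - y, with the larger of the two exponents.
  Unit-+ : ∀ {x y δ} → Unit x → δ ℚ.< 0ℚ → y ∈B δ → Unit (x + y)
  Unit-+ {x} {y} u δ<0 y∈ = unit (∈B-+ (Unit⇒∈B u) (∈B-mono (ℚ.<⇒≤ δ<0) y∈)) λ {ε} ε<0 x+y∈ →
    Unit⇒∉B u (max<0 ε<0 δ<0) (∈B-≈ (solve 2 (λ x y → (x :+ y) :- y := x) refl x y)
      (∈B-- (∈B-mono (ℚ.p≤p⊔q ε _) x+y∈) (∈B-mono (ℚ.p≤q⊔p ε _) y∈)))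
    where
    max<0 : ∀ {s t} → s ℚ.< 0ℚ → t ℚ.< 0ℚ → s ℚ.⊔ t ℚ.< 0ℚ
    max<0 {s} {t} h k with ℚ.≤-total s t
    ... | inj₁ s≤t = ≡.subst (ℚ._< 0ℚ) (≡.sym (ℚ.p≤q⇒p⊔q≡q s≤t)) k
    ... | inj₂ t≤s = ≡.subst (ℚ._< 0ℚ) (≡.sym (ℚ.p≥q⇒p⊔q≡p t≤s)) h

  ∣∣-⁻¹ : ∀ {x s} → ∣ x ∣ ≡ p^ s → ∣ x ⁻¹ ∣ ≡ p^ (ℚ.- s)
  ∣∣-⁻¹ {x} {s} eq = inv ∣ x ⁻¹ ∣ (≡.trans (≡.sym (≡.trans (∣∣-* x (x ⁻¹)) (≡.cong (_*ᵛ ∣ x ⁻¹ ∣) eq)))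
    (≡.trans (∣∣-cong (⁻¹-inverse x≉0)) Unit-1))
    where
    x≉0 : x ≉ 0#
    x≉0 x≈0 = contradiction (≡.trans (≡.sym eq) (∣∣≡𝟎 x≈0)) λ ()
    inv : ∀ v → (p^ s) *ᵛ v ≡ 𝟏 → v ≡ p^ (ℚ.- s)
    inv 𝟎      ()
    inv (p^ t) h = ≡.cong p^_ (Algebra.Properties.Group.inverseʳ-unique ℚ.+-0-group s t (p^-injective h))

  ι-+ : ∀ m n → ι (m ℕ.+ n) ≈ ι m + ι n
  ι-+ = ×-homo-+ 1#

  ι-* : ∀ m n → ι (m ℕ.* n) ≈ ι m * ι n
  ι-* = ×1-homo-*

  ι-1 : ι 1 ≈ 1#
  ι-1 = +-identityʳ 1#

  ι-cong : ∀ {m n} → m ≡ n → ι m ≈ ι n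
  ι-cong ≡.refl = refl

  ι∈B : ∀ n → ι n ∈B 0ℚ
  ι∈B zero    = ≈0⇒∈B refl
  ι∈B (suc n) = ∈B-+ (Unit⇒∈B Unit-1) (ι∈B n)

  -- Bézout gives 1 + y m = x p or 1 + x p = y m. If |m| < 1, the left side is still a unit by
  -- `Unit-+`, while the right side has absolute value below 1.
  p∤⇒Unit : ∀ {m} → ¬ p ∣ m → Unit (ι m)
  p∤⇒Unit {m} p∤m = unit (ι∈B m) λ {δ} δ<0 m∈ → nope δ<0 m∈ (coprime-Bézout coprime)
    where
    coprime : Coprime p m
    coprime {d} (d∣p , d∣m) with prime⇒irreducible prime d∣p
    ... | inj₁ d≡1    = d≡1
    ... | inj₂ ≡.refl = contradiction d∣m p∤m
    nope : ∀ {δ} → δ ℚ.< 0ℚ → ι m ∈B δ → ¬ Bézout.Identity 1 p m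
    nope {δ} δ<0 m∈ (Bézout.+- x y eq) = Unit⇒∉B
      (Unit-+ {y = ι (y ℕ.* m)} Unit-1 δ<0 (∈B-≈ (sym (ι-* y m)) (∈B-Unit* (ι∈B y) m∈)))
      -1<0 (∈B-≈ (trans (sym (ι-* x p)) (sym (ι-cong eq))) (∈B-Unit* (ι∈B x) (∣∣≡⇒∈B ∣p∣)))
    nope {δ} δ<0 m∈ (Bézout.-+ x y eq) = Unit⇒∉B
      (Unit-+ {y = ι (x ℕ.* p)} Unit-1 -1<0 (∈B-≈ (sym (ι-* x p)) (∈B-Unit* (ι∈B x) (∣∣≡⇒∈B ∣p∣))))
      δ<0 (∈B-≈ (trans (sym (ι-* y m)) (sym (ι-cong eq))) (∈B-Unit* (ι∈B y) m∈))

  -- This makes |n| computable: it is exactly p^-N (`p-part-∣∣`), so a bound on |n| becomes a bound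
  -- on N. It is applied to exponents of u and to increments in difference quotients.
  p-part : ∀ n → n ≡ 0 ⊎ ∃ λ N → ∃ λ m → n ≡ m ℕ.* p ℕ.^ N × ¬ p ∣ m
  p-part = <-rec _ step
    where
    step : ∀ n → (∀ {m} → m ℕ.< n → m ≡ 0 ⊎ ∃ λ N → ∃ λ k → m ≡ k ℕ.* p ℕ.^ N × ¬ p ∣ k) →
           n ≡ 0 ⊎ ∃ λ N → ∃ λ m → n ≡ m ℕ.* p ℕ.^ N × ¬ p ∣ m
    step zero    _ = inj₁ ≡.refl
    step n@(suc _) rec with p ∣? n
    ... | no p∤n = inj₂ (0 , n , ≡.sym (ℕ.*-identityʳ n) , p∤n)
    ... | yes (divides zero ())
    ... | yes (divides k@(suc _) eq) with rec {k} (≡.subst (k ℕ.<_) (≡.sym eq)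
                                   (ℕ.m<m*n k p (ℕ.nonTrivial⇒n>1 p ⦃ prime⇒nonTrivial prime ⦄)))
    ... | inj₂ (N , m , eq′ , p∤m) = inj₂ (suc N , m , ≡.trans eq (≡.trans (≡.cong (ℕ._* p) eq′)
            (≡.trans (ℕ.*-assoc m (p ℕ.^ N) p) (≡.cong (m ℕ.*_) (ℕ.*-comm (p ℕ.^ N) p)))) , p∤m)

  ∣ιp^∣ : ∀ N → ∣ ι (p ℕ.^ N) ∣ ≡ p^ (N ·ℚ -1ℚ)
  ∣ιp^∣ zero    = ≡.trans (∣∣-cong ι-1) Unit-1
  ∣ιp^∣ (suc N) = ≡.trans (∣∣-cong (ι-* p (p ℕ.^ N))) (≡.trans (∣∣-* _ _) (≡.cong₂ _*ᵛ_ ∣p∣ (∣ιp^∣ N)))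

  p-part-∣∣ : ∀ m N → ¬ p ∣ m → ∣ ι (m ℕ.* p ℕ.^ N) ∣ ≡ p^ (N ·ℚ -1ℚ)
  p-part-∣∣ m N p∤m = ≡.trans (∣∣-cong (ι-* m (p ℕ.^ N))) (≡.trans (∣∣-* _ _)
    (≡.trans (≡.cong₂ _*ᵛ_ (p∤⇒Unit p∤m) (∣ιp^∣ N)) (≡.cong p^_ (ℚ.+-identityˡ _))))

  -- Characteristic 0 is not an axiom; it follows from the normalisation |p| = 1/p.
  ι≉0 : ∀ n → .⦃ NonZero n ⦄ → ι n ≉ 0#
  ι≉0 n@(suc _) ιn≈0 with p-part n
  ... | inj₂ (N , m , eq , p∤m) =
    contradiction (≡.trans (≡.sym (p-part-∣∣ m N p∤m)) (∣∣≡𝟎 (trans (ι-cong (≡.sym eq)) ιn≈0))) λ ()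

-- Analysis in ℂₚ: limits, sums, p-adic integers and powers.

abstract
  s-r+r≡s : ∀ s r → s ℚ.- r ℚ.+ r ≡ s
  s-r+r≡s = solve 2 (λ s r → s :- r :+ r := s) ≡.refl
    where open ℚ-Solver

  r+[s-r]≡s : ∀ r s → r ℚ.+ (s ℚ.- r) ≡ s
  r+[s-r]≡s = solve 2 (λ r s → r :+ (s :- r) := s) ≡.refl
    where open ℚ-Solver

  -a+[b+a]≡b : ∀ a b → ℚ.- a ℚ.+ (b ℚ.+ a) ≡ b
  -a+[b+a]≡b = solve 2 (λ a b → :- a :+ (b :+ a) := b) ≡.refl
    where open ℚ-Solver

module Analysis {p c ℓ} (prime : Prime p) (ℂₚ : ComplexPAdics p c ℓ) where
  open ComplexPAdics ℂₚ
  open Balls prime valuedField public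
  open Integration ℂₚ
  open Algebra.Properties.Ring ring
  open Algebra.Properties.Semiring.Exp semiring using (^-homo-*; ^-assocʳ; ^-congˡ; ^-congʳ)
  open Algebra.Properties.Semiring.Sum semiring using (sum-cong-≋; ∑-distrib-+; *-distribˡ-sum; *-distribʳ-sum)
  open import Relation.Binary.Reasoning.Setoid setoid
  open K

  -- Limits

  ⟶-cong : ∀ {a b L} → (∀ n → a n ≈ b n) → a ⟶ L → b ⟶ L
  ⟶-cong a≈b a⟶L s with a⟶L s
  ... | N , h = N , λ n N≤n → ∈B-≈ (+-congʳ (a≈b n)) (h n N≤n)

  ⟶-limit-cong : ∀ {a L M} → L ≈ M → a ⟶ L → a ⟶ M
  ⟶-limit-cong L≈M a⟶L s with a⟶L s
  ... | N , h = N , λ n N≤n → ∈B-≈ (+-congˡ (-‿cong L≈M)) (h n N≤n)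

  ⟶-const : ∀ x → (λ _ → x) ⟶ x
  ⟶-const x s = 0 , λ _ _ → ≈⇒∈B refl

  ⟶-suc : ∀ {a L} → a ⟶ L → (a ∘ suc) ⟶ L
  ⟶-suc a⟶L s with a⟶L s
  ... | N , h = N , λ n N≤n → h (suc n) (ℕ.m≤n⇒m≤1+n N≤n)

  ⟶-+ : ∀ {a b L M} → a ⟶ L → b ⟶ M → (λ n → a n + b n) ⟶ (L + M)
  ⟶-+ {a} {b} {L} {M} a⟶L b⟶M s with a⟶L s | b⟶M s
  ... | N , h | N′ , k = N ℕ.⊔ N′ , λ n N≤n →
    ∈B-≈ (solve 4 (λ a b l m → (a :- l) :+ (b :- m) := (a :+ b) :- (l :+ m)) refl (a n) (b n) L M)
         (∈B-+ (h n (ℕ.≤-trans (ℕ.m≤m⊔n N N′) N≤n)) (k n (ℕ.≤-trans (ℕ.m≤n⊔m N N′) N≤n)))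

  ⟶-*ˡ : ∀ {a L} x → a ⟶ L → (λ n → x * a n) ⟶ (x * L)
  ⟶-*ˡ {a} {L} x a⟶L s with bound x
  ... | r , x∈ with a⟶L (s ℚ.- r)
  ... | N , h = N , λ n N≤n → ∈B-≈ (solve 3 (λ x a l → x :* (a :- l) := x :* a :- x :* l) refl x (a n) L)
    (∈B-≡ (r+[s-r]≡s r s) (∈B-* x∈ (h n N≤n)))

  ⟶-- : ∀ {a b L M} → a ⟶ L → b ⟶ M → (λ n → a n - b n) ⟶ (L - M)
  ⟶-- a⟶L b⟶M = ⟶-+ a⟶L (⟶-limit-cong (-1*x≈-x _) (⟶-cong (λ _ → -1*x≈-x _) (⟶-*ˡ (- 1#) b⟶M)))

  ⟶-unique : ∀ {a L M} → a ⟶ L → a ⟶ M → L ≈ M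
  ⟶-unique {a} a⟶L a⟶M = ∈B⇒≈ λ s → let N , h = a⟶L s; N′ , k = a⟶M s in
    ∈B-trans (∈B-swap (h (N ℕ.⊔ N′) (ℕ.m≤m⊔n N N′))) (k (N ℕ.⊔ N′) (ℕ.m≤n⊔m N N′))

  ⟶-∈B : ∀ {a L s} → (∀ n → a n ∈B s) → a ⟶ L → L ∈B s
  ⟶-∈B {a} {L} {s} a∈ a⟶L with a⟶L s
  ... | N , h = ∈B-≈ (solve 2 (λ a l → a :- (a :- l) := l) refl (a N) L) (∈B-- (a∈ N) (h N ℕ.≤-refl))

  private
    module _ {δ} (δ<0 : δ ℚ.< 0ℚ) (r : ℚ) (a : ℕ → Carrier)
             (step : ∀ N → a (suc N) - a N ∈B r ℚ.+ N ·ℚ δ) where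

      -- By the ultrametric inequality the errors of successive steps do not add up: the first step
      -- has the largest bound, which covers all later ones.
      tail : ∀ N k → a (k ℕ.+ N) - a N ∈B r ℚ.+ N ·ℚ δ
      tail N zero    = ≈⇒∈B refl
      tail N (suc k) = ∈B-trans
        (∈B-mono (ℚ.+-monoʳ-≤ r (·ℚ-anti (ℚ.<⇒≤ δ<0) (ℕ.m≤n+m N k))) (step (k ℕ.+ N))) (tail N k)

      tail-≤ : ∀ {N n} → N ℕ.≤ n → a n - a N ∈B r ℚ.+ N ·ℚ δ
      tail-≤ {N} {n} N≤n = ≡.subst (λ m → a m - a N ∈B _) (ℕ.m∸n+n≡m N≤n) (tail N (n ℕ.∸ N))

      cauchy : Cauchy a
      cauchy s with ·ℚ→-∞ δ<0 (s ℚ.- r)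
      ... | N , h = N , λ m n N≤m N≤n → ∈B-mono
        (≡.subst (r ℚ.+ N ·ℚ δ ℚ.≤_) (r+[s-r]≡s r s) (ℚ.+-monoʳ-≤ r (h N ℕ.≤-refl)))
        (∈B-trans (tail-≤ N≤m) (∈B-swap (tail-≤ N≤n)))

      rate : ∀ {L} → a ⟶ L → ∀ N → a N - L ∈B r ℚ.+ N ·ℚ δ
      rate a⟶L N with a⟶L (r ℚ.+ N ·ℚ δ)
      ... | M , h = ∈B-trans (∈B-swap (tail-≤ (ℕ.m≤m⊔n N M))) (h (N ℕ.⊔ M) (ℕ.m≤n⊔m N M))

  abstract
    -- The common source of the values uˣ, the derivatives and the integrals. The rate is kept
    -- because continuity of powers and the estimate of difference quotients depend on it.
    geometric : ∀ {δ} → δ ℚ.< 0ℚ → ∀ r a → (∀ N → a (suc N) - a N ∈B r ℚ.+ N ·ℚ δ) →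
                ∃ λ L → (a ⟶ L) × (∀ N → a N - L ∈B r ℚ.+ N ·ℚ δ)
    geometric δ<0 r a step = let L , a⟶L = complete a (cauchy δ<0 r a step) in
      L , a⟶L , rate δ<0 r a step a⟶L

  -- Finite sums

  ∑ : (ℕ → Carrier) → ℕ → Carrier
  ∑ f n = sum {n} (f ∘ toℕ)

  ∑-cong : ∀ {f g} → (∀ k → f k ≈ g k) → ∀ n → ∑ f n ≈ ∑ g n
  ∑-cong f≈g n = sum-cong-≋ {n} (f≈g ∘ toℕ)

  ∑-last : ∀ f n → ∑ f (suc n) ≈ ∑ f n + f n
  ∑-last f zero    = +-comm (f 0) 0#
  ∑-last f (suc n) = trans (+-congˡ (∑-last (f ∘ suc) n)) (sym (+-assoc _ _ _))

  ∑-+ : ∀ f g n → ∑ (λ k → f k + g k) n ≈ ∑ f n + ∑ g n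
  ∑-+ f g n = ∑-distrib-+ {n} (f ∘ toℕ) (g ∘ toℕ)

  ∑-*ˡ : ∀ x f n → x * ∑ f n ≈ ∑ (λ k → x * f k) n
  ∑-*ˡ x f n = *-distribˡ-sum {n} x (f ∘ toℕ)

  ∑-*ʳ : ∀ x f n → ∑ f n * x ≈ ∑ (λ k → f k * x) n
  ∑-*ʳ x f n = *-distribʳ-sum {n} x (f ∘ toℕ)

  ∑-- : ∀ f g n → ∑ f n - ∑ g n ≈ ∑ (λ k → f k - g k) n
  ∑-- f g zero    = -‿inverseʳ 0#
  ∑-- f g (suc n) = trans (solve 4 (λ a b c d → (a :+ b) :- (c :+ d) := (a :- c) :+ (b :- d)) refl _ _ _ _)
                          (+-congˡ (∑-- (f ∘ suc) (g ∘ suc) n))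

  ∑∈B : ∀ {f s} → (∀ k → f k ∈B s) → ∀ n → ∑ f n ∈B s
  ∑∈B f∈ zero    = ≈0⇒∈B refl
  ∑∈B f∈ (suc n) = ∈B-+ (f∈ 0) (∑∈B (f∈ ∘ suc) n)

  ∑-append : ∀ f m n → ∑ f (m ℕ.+ n) ≈ ∑ f m + ∑ (f ∘ (m ℕ.+_)) n
  ∑-append f zero    n = sym (+-identityˡ _)
  ∑-append f (suc m) n = trans (+-congˡ (∑-append (f ∘ suc) m n)) (sym (+-assoc _ _ _))

  ∑-blocks : ∀ f m n → ∑ f (m ℕ.* n) ≈ ∑ (λ i → ∑ (λ x → f (i ℕ.* n ℕ.+ x)) n) m
  ∑-blocks f zero    n = refl
  ∑-blocks f (suc m) n = trans (∑-append f n (m ℕ.* n)) (+-congˡ (trans (∑-blocks (f ∘ (n ℕ.+_)) m n)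
    (∑-cong (λ i → ∑-cong (λ x → reflexive (≡.cong f (≡.sym (ℕ.+-assoc n (i ℕ.* n) x)))) n) m)))

  ^∈B : ∀ {x δ} → x ∈B δ → ∀ n → x ^ n ∈B n ·ℚ δ
  ^∈B x∈ zero    = Unit⇒∈B Unit-1
  ^∈B x∈ (suc n) = ∈B-* x∈ (^∈B x∈ n)

  ^∈B0 : ∀ {x} → x ∈B 0ℚ → ∀ n → x ^ n ∈B 0ℚ
  ^∈B0 x∈ zero    = Unit⇒∈B Unit-1
  ^∈B0 x∈ (suc n) = ∈B-Unit* x∈ (^∈B0 x∈ n)

  ^-1-factor : ∀ x n → x ^ n - 1# ≈ (x - 1#) * ∑ (x ^_) n
  ^-1-factor x zero    = trans (-‿inverseʳ 1#) (sym (zeroʳ _))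
  ^-1-factor x (suc n) = sym (begin
    (x - 1#) * ∑ (x ^_) (suc n)             ≈⟨ *-congˡ (∑-last (x ^_) n) ⟩
    (x - 1#) * (∑ (x ^_) n + x ^ n)         ≈⟨ distribˡ _ _ _ ⟩
    (x - 1#) * ∑ (x ^_) n + (x - 1#) * x ^ n ≈⟨ +-congʳ (^-1-factor x n) ⟨
    (x ^ n - 1#) + (x - 1#) * x ^ n         ≈⟨ solve 2 (λ x y → (y :- :1) :+ (x :- :1) :* y := x :* y :- :1) refl x (x ^ n) ⟩
    x ^ suc n - 1#                          ∎)

  ^-1∈B : ∀ {x s} → x ∈B 0ℚ → x - 1# ∈B s → ∀ n → x ^ n - 1# ∈B s
  ^-1∈B {x} x∈ x-1∈ n = ∈B-≈ (sym (^-1-factor x n)) (∈B-*Unit x-1∈ (∑∈B (^∈B0 x∈) n))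

  -- xᵖ - 1 = (x - 1) (p + Σ (xⁱ - 1)), and p and all xⁱ - 1 lie in the ball of radius pᵗ.

  ^p-1∈B : ∀ {x s t} → x ∈B 0ℚ → x - 1# ∈B s → x - 1# ∈B t → -1ℚ ℚ.≤ t → x ^ p - 1# ∈B s ℚ.+ t
  ^p-1∈B {x} {s} {t} x∈ x-1∈s x-1∈t -1≤t = ∈B-≈ (sym (^-1-factor x p)) (∈B-* x-1∈s
    (∈B-≈ (solve 2 (λ a b → (a :- b) :+ b := a) refl _ _) (∈B-+ (close p) (∈B-mono -1≤t (∣∣≡⇒∈B ∣p∣)))))
    where
    close : ∀ n → ∑ (x ^_) n - ι n ∈B t
    close zero    = ≈⇒∈B refl
    close (suc n) = ∈B-≈ (sym (begin
        ∑ (x ^_) (suc n) - ι (suc n)           ≈⟨ +-congʳ (∑-last (x ^_) n) ⟩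
        (∑ (x ^_) n + x ^ n) - (1# + ι n)
          ≈⟨ solve 4 (λ a b c d → (a :+ b) :- (c :+ d) := (a :- d) :+ (b :- c)) refl _ _ _ _ ⟩
        (∑ (x ^_) n - ι n) + (x ^ n - 1#)      ∎))
      (∈B-+ (close n) (^-1∈B x∈ x-1∈t n))

  -- p-adic integers

  ι-pred : ∀ n → .⦃ _ : NonZero n ⦄ → ι (ℕ.pred n) ≈ ι n - 1#
  ι-pred (suc n) = solve 2 (λ a b → b := (a :+ b) :- a) refl 1# (ι n)

  p^N→0 : ∀ s → ∃ λ N → ι (p ℕ.^ N) ∈B s
  p^N→0 s = let N , h = ·ℚ→-∞ -1<0 s in
    N , ∈B-mono (h N ℕ.≤-refl) (∣∣≡⇒∈B (∣ιp^∣ N))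

  -- Since -n - n (pᴺ - 1) = -n pᴺ tends to 0, negative integers are limits of natural numbers.
  -- Hence ℕ is dense in `ℤₚ`, and continuous identities can be checked on ℕ.
  -ι-approx : ∀ n s → ∃ λ m → - ι n - ι m ∈B s
  -ι-approx n s = let N , h = p^N→0 s; instance p^N≢0 = ℕ.m^n≢0 p N ⦃ prime⇒nonZero prime ⦄ in
    n ℕ.* ℕ.pred (p ℕ.^ N) , ∈B-≈ (begin
      - (ι n * ι (p ℕ.^ N))                    ≈⟨ solve 2 (λ a b → :- (a :* b) := :- a :- a :* (b :- :1)) refl _ _ ⟩
      - ι n - ι n * (ι (p ℕ.^ N) - 1#)         ≈⟨ +-congˡ (-‿cong (*-congˡ (ι-pred (p ℕ.^ N)))) ⟨
      - ι n - ι n * ι (ℕ.pred (p ℕ.^ N))       ≈⟨ +-congˡ (-‿cong (ι-* n _)) ⟨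
      - ι n - ι (n ℕ.* ℕ.pred (p ℕ.^ N))       ∎)
    (∈B-neg (∈B-Unit* (ι∈B n) h))

  approx : ∀ (x : ℤₚ) s → ∃ λ n → val x - ι n ∈B s
  approx x s with val∈ x s
  ... | ℤ.+ n    , h = n , h
  ... | -[1+ n ] , h = let m , k = -ι-approx (suc n) s in m , ∈B-trans h k

  approx⇒∈ℤₚ : ∀ {x} → (∀ s → ∃ λ n → x - ι n ∈B s) → x ∈ℤₚ
  approx⇒∈ℤₚ h s with h s
  ... | n , k = ℤ.+ n , k

  ∈ℤₚ⇒∈B : ∀ (x : ℤₚ) → val x ∈B 0ℚ
  ∈ℤₚ⇒∈B x = let n , h = approx x 0ℚ in
    ∈B-≈ (solve 2 (λ a b → (a :- b) :+ b := a) refl _ _) (∈B-+ h (ι∈B n))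

  opaque
    +-∈ℤₚ : ∀ x y → (val x + val y) ∈ℤₚ
    +-∈ℤₚ x y = approx⇒∈ℤₚ λ s → let m , h = approx x s; n , k = approx y s in
      m ℕ.+ n , ∈B-≈ (trans (solve 4 (λ a b c d → (a :- c) :+ (b :- d) := (a :+ b) :- (c :+ d)) refl _ _ _ _)
                            (+-congˡ (-‿cong (sym (ι-+ m n))))) (∈B-+ h k)

    neg-∈ℤₚ : ∀ x → (- val x) ∈ℤₚ
    neg-∈ℤₚ x = approx⇒∈ℤₚ λ s → let m , h = approx x s; n , k = -ι-approx m s in
      n , ∈B-trans (∈B-≈ (solve 2 (λ a b → :- (a :- b) := :- a :- :- b) refl _ _) (∈B-neg h)) k

  infixl 6 _+ᶻ_
  infix 8 -ᶻ_

  _+ᶻ_ : ℤₚ → ℤₚ → ℤₚ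
  x +ᶻ y = mkℤₚ (val x + val y) (+-∈ℤₚ x y)

  -ᶻ_ : ℤₚ → ℤₚ
  -ᶻ x = mkℤₚ (- val x) (neg-∈ℤₚ x)

  -- Binomial coefficients

  falling-cong : ∀ {x y} → x ≈ y → ∀ k → falling x k ≈ falling y k
  falling-cong x≈y zero    = refl
  falling-cong x≈y (suc k) = *-cong (falling-cong x≈y k) (+-congʳ x≈y)

  binomial-cong : ∀ {x y} → x ≈ y → ∀ k → binomial x k ≈ binomial y k
  binomial-cong x≈y k = *-congʳ (falling-cong x≈y k)

  -- The definition of `falling` peels off the last factor; here the first one comes off, which
  -- leaves `falling x k` as the common factor for Pascal's rule.
  falling-1+ : ∀ x k → falling (x + 1#) (suc k) ≈ (x + 1#) * falling x k
  falling-1+ x zero = solve 1 (λ x → :1 :* ((x :+ :1) :- con (0 , 0)) := (x :+ :1) :* :1) refl x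
  falling-1+ x (suc k) = begin
    falling (x + 1#) (suc k) * (x + 1# - (1# + ι k))    ≈⟨ *-congʳ (falling-1+ x k) ⟩
    (x + 1#) * falling x k * (x + 1# - (1# + ι k))
      ≈⟨ solve 3 (λ x f i → (x :+ :1) :* f :* (x :+ :1 :- (:1 :+ i))
            := (x :+ :1) :* (f :* (x :- i))) refl x (falling x k) (ι k) ⟩
    (x + 1#) * falling x (suc k)                        ∎

  ι⁻¹ : ∀ n → .⦃ _ : NonZero n ⦄ → ι n * ι n ⁻¹ ≈ 1#
  ι⁻¹ n = ⁻¹-inverse (ι≉0 n)

  inverse-unique : ∀ {x y} → x ≉ 0# → x * y ≈ 1# → y ≈ x ⁻¹
  inverse-unique {x} {y} x≉0 xy≈1 = begin
    y                ≈⟨ *-identityʳ y ⟨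
    y * 1#           ≈⟨ *-congˡ (⁻¹-inverse x≉0) ⟨
    y * (x * x ⁻¹)   ≈⟨ solve 3 (λ x y z → y :* (x :* z) := x :* y :* z) refl x y (x ⁻¹) ⟩
    x * y * x ⁻¹     ≈⟨ *-congʳ xy≈1 ⟩
    1# * x ⁻¹        ≈⟨ *-identityˡ _ ⟩
    x ⁻¹             ∎

  ι[k+1]!⁻¹ : ∀ k → ι (suc k) * ι (suc k !) ⁻¹ ≈ ι (k !) ⁻¹
  ι[k+1]!⁻¹ k = inverse-unique {ι (k !)} (ι≉0 (k !) ⦃ k ℕ.!≢0 ⦄) (begin
    ι (k !) * (ι (suc k) * ι (suc k !) ⁻¹)  ≈⟨ solve 3 (λ a b c → a :* (b :* c) := (b :* a) :* c) refl _ _ _ ⟩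
    ι (suc k) * ι (k !) * ι (suc k !) ⁻¹    ≈⟨ *-congʳ (ι-* (suc k) (k !)) ⟨
    ι (suc k !) * ι (suc k !) ⁻¹            ≈⟨ ι⁻¹ (suc k !) ⦃ suc k ℕ.!≢0 ⦄ ⟩
    1#                                      ∎)

  pascal : ∀ x k → binomial (x + 1#) (suc k) ≈ binomial x (suc k) + binomial x k
  pascal x k = begin
    falling (x + 1#) (suc k) * ι (suc k !) ⁻¹                    ≈⟨ *-congʳ (falling-1+ x k) ⟩
    (x + 1#) * falling x k * ι (suc k !) ⁻¹
      -- Split x + 1 = (x - k) + (k + 1): the first part extends the falling factorial, the second
      -- cancels against (k + 1)!.
      ≈⟨ solve 4 (λ x f i z → (x :+ :1) :* f :* z
            := f :* (x :- i) :* z :+ f :* ((:1 :+ i) :* z)) refl x (falling x k) (ι k) _ ⟩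
    falling x (suc k) * ι (suc k !) ⁻¹ + falling x k * (ι (suc k) * ι (suc k !) ⁻¹) ≈⟨ +-congˡ (*-congˡ (ι[k+1]!⁻¹ k)) ⟩
    binomial x (suc k) + binomial x k                            ∎

  binomial-0 : ∀ x → binomial x 0 ≈ 1#
  binomial-0 x = trans (*-congʳ (sym ι-1)) (ι⁻¹ 1)

  falling-0 : ∀ k → falling 0# (suc k) ≈ 0#
  falling-0 zero    = trans (*-congˡ (-‿inverseʳ 0#)) (zeroʳ _)
  falling-0 (suc k) = trans (*-congʳ (falling-0 k)) (zeroˡ _)

  binomial-0-suc : ∀ k → binomial 0# (suc k) ≈ 0#
  binomial-0-suc k = trans (*-congʳ (falling-0 k)) (zeroˡ _)

  -- The quotient by k! hides integrality; induction along Pascal's rule avoids any divisibility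
  -- argument.
  binomial-ι∈B : ∀ n k → binomial (ι n) k ∈B 0ℚ
  binomial-ι∈B n       zero    = ∈B-≈ (sym (binomial-0 (ι n))) (Unit⇒∈B Unit-1)
  binomial-ι∈B zero    (suc k) = ≈0⇒∈B (binomial-0-suc k)
  binomial-ι∈B (suc n) (suc k) = ∈B-≈ (sym (trans (binomial-cong (+-comm 1# (ι n)) (suc k)) (pascal (ι n) k)))
    (∈B-+ (binomial-ι∈B n (suc k)) (binomial-ι∈B n k))

  falling∈B : ∀ {x} → x ∈B 0ℚ → ∀ k → falling x k ∈B 0ℚ
  falling∈B x∈ zero    = Unit⇒∈B Unit-1
  falling∈B x∈ (suc k) = ∈B-Unit* (falling∈B x∈ k) (∈B-- x∈ (ι∈B k))

  falling-lipschitz : ∀ {x y t} → x ∈B 0ℚ → y ∈B 0ℚ → x - y ∈B t → ∀ k → falling x k - falling y k ∈B t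
  falling-lipschitz x∈ y∈ x-y∈ zero    = ≈⇒∈B refl
  falling-lipschitz {x} {y} x∈ y∈ x-y∈ (suc k) = ∈B-≈
    (solve 5 (λ f g x y i → f :* (x :- y) :+ (f :- g) :* (y :- i) := f :* (x :- i) :- g :* (y :- i)) refl _ _ x y (ι k))
    (∈B-+ (∈B-Unit* (falling∈B x∈ k) x-y∈) (∈B-*Unit (falling-lipschitz x∈ y∈ x-y∈ k) (∈B-- y∈ (ι∈B k))))

  binomial-lipschitz : ∀ k → ∃ λ r → ∀ {x y t} → x ∈B 0ℚ → y ∈B 0ℚ → x - y ∈B t →
                       binomial x k - binomial y k ∈B t ℚ.+ r
  binomial-lipschitz k = let r , r∈ = bound (ι (k !) ⁻¹) in
    r , λ x∈ y∈ x-y∈ → ∈B-≈ (solve 3 (λ a b c → (a :- b) :* c := a :* c :- b :* c) refl _ _ _)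
    (∈B-* (falling-lipschitz x∈ y∈ x-y∈ k) r∈)

  -- The factor 1/k! costs a constant pʳ in the Lipschitz bound; approximating x by a natural number
  -- to within p^-r compensates for it.
  binomial∈B : ∀ (x : ℤₚ) k → binomial (val x) k ∈B 0ℚ
  binomial∈B x k = let r , lip = binomial-lipschitz k; n , h = approx x (0ℚ ℚ.- r) in
    ∈B-≈ (solve 2 (λ a b → (a :- b) :+ b := a) refl _ _)
    (∈B-+ (∈B-≡ (s-r+r≡s 0ℚ r) (lip (∈ℤₚ⇒∈B x) (ι∈B n) h)) (binomial-ι∈B n k))

  -- The p-adic power function

  module Power (u : Carrier) {δ} (δ<0 : δ ℚ.< 0ℚ) (u-1∈ : u - 1# ∈B δ) where

    private
      v = u - 1#

      term : Carrier → ℕ → Carrier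
      term x k = binomial x k * v ^ k

    v∈B0 : v ∈B 0ℚ
    v∈B0 = ∈B-mono (ℚ.<⇒≤ δ<0) u-1∈

    u∈B0 : u ∈B 0ℚ
    u∈B0 = ∈B-≈ (solve 1 (λ u → (u :- :1) :+ :1 := u) refl u) (∈B-+ v∈B0 (Unit⇒∈B Unit-1))

    abstract
      series : ∀ (x : ℤₚ) → ∃ λ L → (∑ (term (val x)) ⟶ L) × (∀ N → ∑ (term (val x)) N - L ∈B 0ℚ ℚ.+ N ·ℚ δ)
      series x = geometric δ<0 0ℚ (∑ (term (val x))) λ N → ∈B-≈
        (sym (trans (+-congʳ (∑-last (term (val x)) N)) (solve 2 (λ a b → a :+ b :- a := b) refl _ _)))
        (∈B-* (binomial∈B x N) (^∈B u-1∈ N))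

    pow : ℤₚ → Carrier
    pow x = proj₁ (series x)

    pow-limit : ∀ x → IsPower u (val x) (pow x)
    pow-limit x = proj₁ (proj₂ (series x))

    pow-isPower : ∀ x {y} → val x ≈ y → IsPower u y (pow x)
    pow-isPower x x≈y = ⟶-cong (λ n → ∑-cong {term (val x)} (λ k → *-congʳ (binomial-cong x≈y k)) n) (pow-limit x)

    private
      -- The exponent r depends on N, through 1/k!, so this yields only continuity of the power
      -- function; the linear bound `pow-lipschitz` needs a different argument.
      partial-lipschitz : ∀ N → ∃ λ r → ∀ {x y t} → x ∈B 0ℚ → y ∈B 0ℚ → x - y ∈B t →
                          ∑ (term x) N - ∑ (term y) N ∈B t ℚ.+ r
      partial-lipschitz zero = 0ℚ , λ _ _ _ → ≈⇒∈B refl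
      partial-lipschitz (suc N) = let r , lip = partial-lipschitz N; r′ , lip′ = binomial-lipschitz N in
        r ℚ.⊔ r′ , λ {x} {y} {t} x∈ y∈ h → ∈B-≈ (sym (begin
          ∑ (term x) (suc N) - ∑ (term y) (suc N)                   ≈⟨ +-cong (∑-last (term x) N) (-‿cong (∑-last (term y) N)) ⟩
          (∑ (term x) N + term x N) - (∑ (term y) N + term y N)
            ≈⟨ solve 5 (λ a b c d e → (a :+ b :* e) :- (c :+ d :* e) := (a :- c) :+ (b :- d) :* e) refl _ _ _ _ _ ⟩
          (∑ (term x) N - ∑ (term y) N) + (binomial x N - binomial y N) * v ^ N ∎))
        (∈B-+ (∈B-mono (ℚ.+-monoʳ-≤ t (ℚ.p≤p⊔q r r′)) (lip x∈ y∈ h))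
              (∈B-mono (ℚ.+-monoʳ-≤ t (ℚ.p≤q⊔p r r′)) (∈B-*Unit (lip′ x∈ y∈ h) (^∈B0 v∈B0 N))))

    -- The series converges uniformly: one truncation index N serves all points, and the truncated
    -- sum loses only the factor pʳ.
    pow-continuous : ∀ s → ∃ λ t → ∀ {x y} → val x - val y ∈B t → pow x - pow y ∈B s
    pow-continuous s = let N , h = ·ℚ→-∞ δ<0 s
                           r , lip = partial-lipschitz N
                           close : ∀ x → ∑ (term (val x)) N - pow x ∈B s
                           close x = ∈B-mono (≡.subst (ℚ._≤ s) (≡.sym (ℚ.+-identityˡ _)) (h N ℕ.≤-refl))
                                       (proj₂ (proj₂ (series x)) N)
                       in
      s ℚ.- r , λ {x} {y} x-y∈ → ∈B-trans (∈B-swap (close x))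
        (∈B-trans (∈B-≡ (s-r+r≡s s r) (lip (∈ℤₚ⇒∈B x) (∈ℤₚ⇒∈B y) x-y∈)) (close y))

    -- Pascal's rule holds term by term, with one summand an index lower. Sums of n + 1 terms
    -- therefore meet v times a sum of n terms, and in the limit 1 + v = u.
    pow-+1 : ∀ {x y} → val y ≈ val x + 1# → pow y ≈ u * pow x
    pow-+1 {x} {y} y≈x+1 = trans (⟶-unique (⟶-suc (pow-limit y))
      (⟶-cong (sym ∘ step) (⟶-+ (⟶-suc (pow-limit x)) (⟶-*ˡ v (pow-limit x)))))
      (solve 2 (λ u w → w :+ (u :- :1) :* w := u :* w) refl u (pow x))
      where
      term-suc : ∀ k → term (val y) (suc k) ≈ term (val x) (suc k) + v * term (val x) k
      term-suc k = trans (*-congʳ (trans (binomial-cong y≈x+1 (suc k)) (pascal (val x) k)))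
        (solve 4 (λ a b v w → (a :+ b) :* (v :* w) := a :* (v :* w) :+ v :* (b :* w)) refl _ _ v (v ^ k))

      step : ∀ n → ∑ (term (val y)) (suc n) ≈ ∑ (term (val x)) (suc n) + v * ∑ (term (val x)) n
      step n = begin
        term (val y) 0 + ∑ (term (val y) ∘ suc) n
          ≈⟨ +-cong (*-congʳ (trans (binomial-0 (val y)) (sym (binomial-0 (val x))))) (∑-cong term-suc n) ⟩
        term (val x) 0 + ∑ (λ k → term (val x) (suc k) + v * term (val x) k) n
          ≈⟨ +-congˡ (∑-+ (term (val x) ∘ suc) (λ k → v * term (val x) k) n) ⟩
        term (val x) 0 + (∑ (term (val x) ∘ suc) n + ∑ (λ k → v * term (val x) k) n)
          ≈⟨ +-assoc _ _ _ ⟨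
        ∑ (term (val x)) (suc n) + ∑ (λ k → v * term (val x) k) n
          ≈⟨ +-congˡ (∑-*ˡ v (term (val x)) n) ⟨
        ∑ (term (val x)) (suc n) + v * ∑ (term (val x)) n ∎

    pow-ι : ∀ n {x} → val x ≈ ι n → pow x ≈ u ^ n
    pow-ι zero {x} x≈0 = ⟶-unique (⟶-suc (pow-limit x)) (⟶-cong (sym ∘ const) (⟶-const 1#))
      where
      const : ∀ n → ∑ (term (val x)) (suc n) ≈ 1#
      const n = begin
        binomial (val x) 0 * 1# + ∑ (term (val x) ∘ suc) n
          ≈⟨ +-cong (trans (*-identityʳ _) (binomial-0 (val x))) (∑-cong {term (val x) ∘ suc}
                (λ k → trans (*-congʳ (trans (binomial-cong x≈0 (suc k)) (binomial-0-suc k))) (trans (zeroˡ _) (sym (zeroˡ 0#)))) n) ⟩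
        1# + ∑ (λ _ → 0# * 0#) n     ≈⟨ +-congˡ (∑-*ˡ 0# (λ _ → 0#) n) ⟨
        1# + 0# * ∑ (λ _ → 0#) n     ≈⟨ +-congˡ (zeroˡ _) ⟩
        1# + 0#                      ≈⟨ +-identityʳ 1# ⟩
        1#                           ∎
    pow-ι (suc n) {x} x≈ = trans (pow-+1 {ℕ→ℤₚ n} {x} (trans x≈ (+-comm 1# (ι n)))) (*-congˡ (pow-ι n refl))

    pow-approx : ∀ x s t → ∃ λ n → val x - ι n ∈B t × pow x - u ^ n ∈B s
    pow-approx x s t = let t′ , cont = pow-continuous s; n , h = approx x (t ℚ.⊓ t′) in
      n , ∈B-mono (ℚ.p⊓q≤p t t′) h ,
      ∈B-≈ (+-congˡ (-‿cong (pow-ι n refl))) (cont {x} {ℕ→ℤₚ n} (∈B-mono (ℚ.p⊓q≤q t t′) h))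

    pow∈B0 : ∀ x → pow x ∈B 0ℚ
    pow∈B0 x = let n , _ , h = pow-approx x 0ℚ 0ℚ in
      ∈B-≈ (solve 2 (λ a b → (a :- b) :+ b := a) refl _ _) (∈B-+ h (^∈B0 u∈B0 n))

    -- On natural numbers this is u^(m + n) = u^m u^n; continuity and the density of ℕ carry it over
    -- to `ℤₚ`.
    pow-+ : ∀ {x y z} → val z ≈ val x + val y → pow z ≈ pow x * pow y
    pow-+ {x} {y} {z} z≈x+y = ∈B⇒≈ close
      where
      close : ∀ s → pow z - pow x * pow y ∈B s
      close s = let t , cont = pow-continuous s
                    m , x-m , px = pow-approx x s t
                    n , y-n , py = pow-approx y s t
                in ∈B-trans
        (∈B-≈ (+-congˡ (-‿cong (trans (pow-ι (m ℕ.+ n) refl) (^-homo-* u m n))))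
          (cont {z} {ℕ→ℤₚ (m ℕ.+ n)} (∈B-≈
            (trans (solve 4 (λ a b c d → (a :- c) :+ (b :- d) := (a :+ b) :- (c :+ d)) refl _ _ _ _)
              (+-cong (sym z≈x+y) (-‿cong (sym (ι-+ m n)))))
            (∈B-+ x-m y-n))))
        (∈B-swap (∈B-≈ (solve 4 (λ a b c d → (a :- c) :* b :+ c :* (b :- d) := a :* b :- c :* d) refl _ _ _ _)
          (∈B-+ (∈B-*Unit px (pow∈B0 y)) (∈B-Unit* (^∈B0 u∈B0 m) py))))

    private
      -- The summand p in xᵖ - 1 = (x - 1)(p + ⋯) caps the guaranteed gain at 1/p, so an exponent
      -- below -1 is raised to -1.
      δ′ = δ ℚ.⊔ -1ℚ

      -1≤δ′ : -1ℚ ℚ.≤ δ′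
      -1≤δ′ = ℚ.p≤q⊔p δ -1ℚ

      δ′<0 : δ′ ℚ.< 0ℚ
      δ′<0 with ℚ.≤-total δ -1ℚ
      ... | inj₁ h = ≡.subst (ℚ._< 0ℚ) (≡.sym (ℚ.p≤q⇒p⊔q≡q h)) -1<0
      ... | inj₂ h = ≡.subst (ℚ._< 0ℚ) (≡.sym (ℚ.p≥q⇒p⊔q≡p h)) δ<0

      y : ℕ → Carrier
      y N = u ^ (p ℕ.^ N)

      y∈B0 : ∀ N → y N ∈B 0ℚ
      y∈B0 N = ^∈B0 u∈B0 (p ℕ.^ N)

      y-suc : ∀ N → y (suc N) ≈ y N ^ p
      y-suc N = trans (^-congʳ u (ℕ.*-comm p (p ℕ.^ N))) (sym (^-assocʳ u (p ℕ.^ N) p))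

      -- Every p-th power gains the factor pᵟ′; from M on, |y N - 1| ≤ 1/p, and it gains 1/p.

      slow : ∀ N → y N - 1# ∈B suc N ·ℚ δ′
      slow zero    = ∈B-≈ (+-congʳ (sym (*-identityʳ u)))
                       (∈B-≡ (≡.sym (ℚ.+-identityʳ δ′)) (∈B-mono (ℚ.p≤p⊔q δ -1ℚ) u-1∈))
      slow (suc N) = ∈B-≈ (+-congʳ (sym (y-suc N))) (∈B-≡ (ℚ.+-comm (suc N ·ℚ δ′) δ′)
        (^p-1∈B (y∈B0 N) (slow N)
          (∈B-mono (≡.subst (suc N ·ℚ δ′ ℚ.≤_) (ℚ.+-identityʳ δ′) (·ℚ-anti {1} {suc N} (ℚ.<⇒≤ δ′<0) (ℕ.s≤s ℕ.z≤n))) (slow N)) -1≤δ′))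

      M : ℕ
      M = proj₁ (·ℚ→-∞ δ′<0 -1ℚ)

      small : ∀ {N} → M ℕ.≤ N → y N - 1# ∈B -1ℚ
      small {N} M≤N = ∈B-mono (proj₂ (·ℚ→-∞ δ′<0 -1ℚ) (suc N) (ℕ.m≤n⇒m≤1+n M≤N)) (slow N)

      fast : ∀ k → y (k ℕ.+ M) - 1# ∈B suc k ·ℚ -1ℚ
      fast zero    = small ℕ.≤-refl
      fast (suc k) = ∈B-≈ (+-congʳ (sym (y-suc (k ℕ.+ M)))) (∈B-≡ (ℚ.+-comm (suc k ·ℚ -1ℚ) -1ℚ)
        (^p-1∈B (y∈B0 (k ℕ.+ M)) (fast k) (small (ℕ.m≤n+m M k)) ℚ.≤-refl))

    -- This is M as a rational number. The resulting bound p^(M - N) on u^(pᴺ) - 1 is trivial for N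
    -- ≤ M and follows from `fast` for N ≥ M.
    κ : ℚ
    κ = ℚ.- (M ·ℚ -1ℚ)

    private
      y-1∈B : ∀ N → y N - 1# ∈B κ ℚ.+ N ·ℚ -1ℚ
      y-1∈B N with ℕ.≤-total M N
      ... | inj₁ M≤N = ≡.subst (λ n → y n - 1# ∈B κ ℚ.+ n ·ℚ -1ℚ) (ℕ.m∸n+n≡m M≤N) (∈B-≡
        (≡.sym (≡.trans (≡.cong (κ ℚ.+_) (·ℚ-homo-+ -1ℚ (N ℕ.∸ M) M)) (-a+[b+a]≡b (M ·ℚ -1ℚ) ((N ℕ.∸ M) ·ℚ -1ℚ))))
        (∈B-mono (·ℚ-anti {N ℕ.∸ M} (ℚ.<⇒≤ -1<0) (ℕ.n≤1+n _)) (fast (N ℕ.∸ M))))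
      ... | inj₂ N≤M = ∈B-mono (≡.subst (ℚ._≤ κ ℚ.+ N ·ℚ -1ℚ) (ℚ.+-inverseˡ (M ·ℚ -1ℚ))
        (ℚ.+-monoʳ-≤ κ (·ℚ-anti (ℚ.<⇒≤ -1<0) N≤M))) (∈B-- (y∈B0 N) (Unit⇒∈B Unit-1))

    -- For n = m pᴺ with p not dividing m, |n| = p^-N, and taking the m-th power of u^(pᴺ) does not
    -- increase its distance to 1.
    ^-lipschitz : ∀ n {t} → ι n ∈B t → u ^ n - 1# ∈B κ ℚ.+ t
    ^-lipschitz n {t} n∈ with p-part n
    ... | inj₁ ≡.refl = ≈⇒∈B refl
    ... | inj₂ (N , m , ≡.refl , p∤m) = ∈B-≈
      (+-congʳ (trans (^-assocʳ u (p ℕ.^ N) m) (^-congʳ u (ℕ.*-comm (p ℕ.^ N) m))))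
      (^-1∈B (y∈B0 N) (∈B-mono (ℚ.+-monoʳ-≤ κ (∈B⇒≤ (p-part-∣∣ m N p∤m) n∈)) (y-1∈B N)) m)

    pow-lipschitz : ∀ h {t} → val h ∈B t → pow h - 1# ∈B κ ℚ.+ t
    pow-lipschitz h {t} h∈ = let n , h-n , ph = pow-approx h (κ ℚ.+ t) t in
      ∈B-trans ph (^-lipschitz n
      (∈B-≈ (solve 2 (λ a b → a :- (a :- b) := b) refl _ _) (∈B-- h∈ h-n)))

-- Exponent arithmetic, the class 𝒟 and differentiability.

abstract
  [a+x]+b : ∀ a x b → a ℚ.+ x ℚ.+ b ≡ a ℚ.+ b ℚ.+ x
  [a+x]+b = solve 3 (λ a x b → a :+ x :+ b := a :+ b :+ x) ≡.refl
    where open ℚ-Solver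

  [a+t]+[b+s] : ∀ a t b s → (a ℚ.+ t) ℚ.+ (b ℚ.+ s) ≡ a ℚ.+ b ℚ.+ (s ℚ.+ t)
  [a+t]+[b+s] = solve 4 (λ a t b s → (a :+ t) :+ (b :+ s) := a :+ b :+ (s :+ t)) ≡.refl
    where open ℚ-Solver

  a+[b+x] : ∀ a b x → a ℚ.+ (b ℚ.+ x) ≡ a ℚ.+ b ℚ.+ x
  a+[b+x] a b x = ≡.sym (ℚ.+-assoc a b x)

  [a+[n+n]]-[-e+n] : ∀ e a n → (a ℚ.+ (n ℚ.+ n)) ℚ.- (ℚ.- e ℚ.+ n) ≡ a ℚ.+ e ℚ.+ n
  [a+[n+n]]-[-e+n] = solve 3 (λ e a n → (a :+ (n :+ n)) :- (:- e :+ n) := a :+ e :+ n) ≡.refl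
    where open ℚ-Solver

  -- A member of `𝒟` carries one constant for three estimates; a character needs 0 for boundedness,
  -- κ for the Lipschitz bound and κ + κ for the second difference.
  common-bound : ∀ κ → ∃ λ r → 0ℚ ℚ.≤ r × κ ℚ.≤ r × κ ℚ.+ κ ℚ.≤ r
  common-bound κ = 0ℚ ℚ.⊔ m , ℚ.p≤p⊔q 0ℚ m , ℚ.≤-trans (ℚ.p≤p⊔q κ (κ ℚ.+ κ)) m≤ , ℚ.≤-trans (ℚ.p≤q⊔p κ (κ ℚ.+ κ)) m≤
    where
    m : ℚ
    m = κ ℚ.⊔ (κ ℚ.+ κ)
    m≤ : m ℚ.≤ 0ℚ ℚ.⊔ m
    m≤ = ℚ.p≤q⊔p 0ℚ m

module Smooth {p c ℓ} (prime : Prime p) (ℂₚ : ComplexPAdics p c ℓ) where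
  open ComplexPAdics ℂₚ
  open Analysis prime ℂₚ public
  open Integration ℂₚ
  open import Relation.Binary.Reasoning.Setoid setoid
  open K

  record 𝒟 : Set (c ⊔ ℓ) where
    field
      fun       : ℤₚ → Carrier
      size      : ℚ
      bounded   : ∀ x → fun x ∈B size
      lipschitz : ∀ {x y t} → val x - val y ∈B t → fun x - fun y ∈B size ℚ.+ t
      smooth    : ∀ {x y z w s t} → val x - val y ≈ val z - val w →
                  val x - val y ∈B s → val x - val z ∈B t →
                  (fun x - fun y) - (fun z - fun w) ∈B size ℚ.+ (s ℚ.+ t)

    -- The distance of equal points lies below every radius, so the Lipschitz bound already forces
    -- equal values and congruence need not be a field.
    fun-cong : ∀ {x y} → val x ≈ val y → fun x ≈ fun y
    fun-cong {x} {y} x≈y = ∈B⇒≈ λ s → ∈B-≡ (r+[s-r]≡s size s) (lipschitz {x} {y} {s ℚ.- size} (≈⇒∈B x≈y))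

  open 𝒟 public

  parallelogram : ∀ {x y z w} → x - y ≈ z - w → x - z ≈ y - w
  parallelogram {x} {y} {z} {w} h = begin
    x - z               ≈⟨ solve 3 (λ x y z → x :- z := (x :- y) :+ (y :- z)) refl x y z ⟩
    (x - y) + (y - z)   ≈⟨ +-congʳ h ⟩
    (z - w) + (y - z)   ≈⟨ solve 3 (λ y z w → (z :- w) :+ (y :- z) := y :- w) refl y z w ⟩
    y - w               ∎

  constᴰ : Carrier → 𝒟
  constᴰ k = let r , k∈ = bound k in record
    { fun       = λ _ → k
    ; size      = r
    ; bounded   = λ _ → k∈
    ; lipschitz = λ _ → ≈⇒∈B refl
    ; smooth    = λ _ _ _ → ≈⇒∈B refl
    }

  idᴰ : 𝒟
  idᴰ = record
    { fun       = val
    ; size      = 0ℚ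
    ; bounded   = ∈ℤₚ⇒∈B
    ; lipschitz = ∈B-≡ (≡.sym (ℚ.+-identityˡ _))
    ; smooth    = λ h _ _ → ≈⇒∈B h
    }

  infixl 6 _-ᴰ_
  infixl 7 _*ᴰ_
  infixr 8 _^ᴰ_

  _-ᴰ_ : 𝒟 → 𝒟 → 𝒟
  f -ᴰ g = record
    { fun       = λ x → fun f x - fun g x
    ; size      = r
    ; bounded   = λ x → ∈B-- (∈B-mono f≤ (bounded f x)) (∈B-mono g≤ (bounded g x))
    ; lipschitz = λ {x} {y} {t} h → ∈B-≈ (solve 4 (λ a b c d → (a :- b) :- (c :- d) := (a :- c) :- (b :- d)) refl _ _ _ _)
        (∈B-- (∈B-mono (ℚ.+-monoˡ-≤ t f≤) (lipschitz f {x} {y} h)) (∈B-mono (ℚ.+-monoˡ-≤ t g≤) (lipschitz g {x} {y} h)))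
    ; smooth    = λ {x} {y} {z} {w} {s} {t} e h k → ∈B-≈
        (solve 8 (λ a b c d a′ b′ c′ d′ → ((a :- b) :- (c :- d)) :- ((a′ :- b′) :- (c′ :- d′))
                    := ((a :- a′) :- (b :- b′)) :- ((c :- c′) :- (d :- d′))) refl _ _ _ _ _ _ _ _)
        (∈B-- (∈B-mono (ℚ.+-monoˡ-≤ (s ℚ.+ t) f≤) (smooth f {x} {y} {z} {w} e h k))
              (∈B-mono (ℚ.+-monoˡ-≤ (s ℚ.+ t) g≤) (smooth g {x} {y} {z} {w} e h k)))
    }
    where
    r = size f ℚ.⊔ size g
    f≤ : size f ℚ.≤ r
    f≤ = ℚ.p≤p⊔q (size f) (size g)
    g≤ : size g ℚ.≤ r
    g≤ = ℚ.p≤q⊔p (size f) (size g)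

  _*ᴰ_ : 𝒟 → 𝒟 → 𝒟
  f *ᴰ g = record
    { fun       = λ x → F x * G x
    ; size      = a ℚ.+ b
    ; bounded   = λ x → ∈B-* (bounded f x) (bounded g x)
    ; lipschitz = λ {x} {y} {t} h → ∈B-≈
        (solve 4 (λ fx fy gx gy → (fx :- fy) :* gx :+ fy :* (gx :- gy) := fx :* gx :- fy :* gy) refl (F x) (F y) (G x) (G y))
        (∈B-+ (∈B-≡ ([a+x]+b a t b) (∈B-* (lipschitz f {x} {y} h) (bounded g x)))
              (∈B-≡ (a+[b+x] a b t) (∈B-* (bounded f y) (lipschitz g {x} {y} h))))
    ; smooth    = λ {x} {y} {z} {w} {s} {t} e h k → ∈B-≈
        -- The second difference of a product has two terms with a second difference of one factor
        -- and two terms with first differences of both factors. In the latter the differences run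
        -- along different sides of the parallelogram, one of size s and one of size t.
        (solve 8 (λ fx fy fz fw gx gy gz gw →
            (((fx :- fy) :- (fz :- fw)) :* gx :+ (fy :- fw) :* (gx :- gy)) :+
            ((fz :- fw) :* (gy :- gw) :+ fz :* ((gx :- gy) :- (gz :- gw)))
            := (fx :* gx :- fy :* gy) :- (fz :* gz :- fw :* gw)) refl (F x) (F y) (F z) (F w) (G x) (G y) (G z) (G w))
        (∈B-+
          (∈B-+ (∈B-≡ ([a+x]+b a (s ℚ.+ t) b) (∈B-* (smooth f {x} {y} {z} {w} e h k) (bounded g x)))
                (∈B-≡ ([a+t]+[b+s] a t b s)
                  (∈B-* (lipschitz f {y} {w} (∈B-≈ (parallelogram e) k)) (lipschitz g {x} {y} h))))
          (∈B-+ (∈B-≡ (≡.trans ([a+t]+[b+s] a s b t) (≡.cong (a ℚ.+ b ℚ.+_) (ℚ.+-comm t s)))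
                  (∈B-* (lipschitz f {z} {w} (∈B-≈ e h)) (lipschitz g {y} {w} (∈B-≈ (parallelogram e) k))))
                (∈B-≡ (a+[b+x] a b (s ℚ.+ t)) (∈B-* (bounded f z) (smooth g {x} {y} {z} {w} e h k)))))
    }
    where
    F = fun f
    G = fun g
    a = size f
    b = size g

  _^ᴰ_ : 𝒟 → ℕ → 𝒟
  f ^ᴰ zero  = constᴰ 1#
  f ^ᴰ suc n = f *ᴰ f ^ᴰ n

  fun-^ᴰ : ∀ f n x → fun (f ^ᴰ n) x ≈ fun f x ^ n
  fun-^ᴰ f zero    x = refl
  fun-^ᴰ f (suc n) x = *-congˡ (fun-^ᴰ f n x)

  translate : ℤₚ → 𝒟 → 𝒟
  translate c f = record
    { fun       = λ x → fun f (c +ᶻ x)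
    ; size      = size f
    ; bounded   = λ x → bounded f (c +ᶻ x)
    ; lipschitz = λ {x} {y} h → lipschitz f {c +ᶻ x} {c +ᶻ y} (∈B-≈ (shift (val x) (val y)) h)
    ; smooth    = λ {x} {y} {z} {w} e h k → smooth f {c +ᶻ x} {c +ᶻ y} {c +ᶻ z} {c +ᶻ w}
        (trans (sym (shift (val x) (val y))) (trans e (shift (val z) (val w))))
        (∈B-≈ (shift (val x) (val y)) h) (∈B-≈ (shift (val x) (val z)) k)
    }
    where
    shift : ∀ x y → x - y ≈ (val c + x) - (val c + y)
    shift = solve 3 (λ c x y → x :- y := (c :+ x) :- (c :+ y)) refl (val c)

  -- Only these three properties of x ↦ uˣ are used, so q^(-x) is covered by composing the power
  -- function with negation.
  module _ (χ : ℤₚ → Carrier) (κ : ℚ) (χ∈B0 : ∀ x → χ x ∈B 0ℚ)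
           (χ-+ : ∀ {x y z} → val z ≈ val x + val y → χ z ≈ χ x * χ y)
           (χ-lipschitz : ∀ h {t} → val h ∈B t → χ h - 1# ∈B κ ℚ.+ t) where

    private
      r = proj₁ (common-bound κ)
      0≤r = proj₁ (proj₂ (common-bound κ))
      κ≤r = proj₁ (proj₂ (proj₂ (common-bound κ)))
      κ+κ≤r = proj₂ (proj₂ (proj₂ (common-bound κ)))

      χ-decompose : ∀ x y → χ x ≈ χ y * χ (x +ᶻ -ᶻ y)
      χ-decompose x y = χ-+ {y} {x +ᶻ -ᶻ y} {x} (solve 2 (λ x y → x := y :+ (x :- y)) refl (val x) (val y))

    characterᴰ : 𝒟
    characterᴰ = record
      { fun       = χ
      ; size      = r
      ; bounded   = λ x → ∈B-mono 0≤r (χ∈B0 x)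
      ; lipschitz = λ {x} {y} {t} h → ∈B-≈ (sym (begin
            χ x - χ y                           ≈⟨ +-congʳ (χ-decompose x y) ⟩
            χ y * χ (x +ᶻ -ᶻ y) - χ y           ≈⟨ solve 2 (λ a b → a :* b :- a := a :* (b :- :1)) refl _ _ ⟩
            χ y * (χ (x +ᶻ -ᶻ y) - 1#)          ∎))
          (∈B-Unit* (χ∈B0 y) (∈B-mono (ℚ.+-monoˡ-≤ t κ≤r) (χ-lipschitz (x +ᶻ -ᶻ y) h)))
      ; smooth    = λ {x} {y} {z} {w} {s} {t} e h k →
          let H = x +ᶻ -ᶻ y; L = x +ᶻ -ᶻ z
              χy : χ y ≈ χ w * χ L
              χy = χ-+ {w} {L} {y} (trans (solve 2 (λ y w → y := w :+ (y :- w)) refl (val y) (val w)) (+-congˡ (sym (parallelogram e))))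
              χz : χ z ≈ χ w * χ H
              χz = χ-+ {w} {H} {z} (trans (solve 2 (λ y w → y := w :+ (y :- w)) refl (val z) (val w)) (+-congˡ (sym e)))
          in ∈B-≈ (sym (begin
            (χ x - χ y) - (χ z - χ w)
              ≈⟨ +-cong (+-cong (trans (χ-decompose x y) (*-congʳ χy)) (-‿cong χy)) (-‿cong (+-congʳ χz)) ⟩
            (χ w * χ L * χ H - χ w * χ L) - (χ w * χ H - χ w)
              ≈⟨ solve 3 (λ w l h → (w :* l :* h :- w :* l) :- (w :* h :- w) := w :* ((h :- :1) :* (l :- :1))) refl _ _ _ ⟩
            χ w * ((χ H - 1#) * (χ L - 1#)) ∎))
          (∈B-Unit* (χ∈B0 w) (∈B-mono (ℚ.+-monoˡ-≤ (s ℚ.+ t) κ+κ≤r) (∈B-≡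
            (≡.trans ([a+t]+[b+s] κ s κ t) (≡.cong (κ ℚ.+ κ ℚ.+_) (ℚ.+-comm t s)))
            (∈B-* (χ-lipschitz H h) (χ-lipschitz L k)))))
      }

  -- Differentiability

  module Derivative (f : 𝒟) where

    private
      F = fun f
      A = size f

      ν : ℕ → ℚ
      ν N = N ·ℚ -1ℚ

      Δ : ℤₚ → ℕ → Carrier
      Δ a n = F (a +ᶻ ℕ→ℤₚ n) - F a

      -- The increments over a step k, taken at a + m k and at a, differ by O(|k| |m k|), hence by
      -- O(|k|²), and summing over the steps does not enlarge an ultrametric error.
      Δ-multiple : ∀ a k {e} → ι k ∈B e → ∀ m → Δ a (m ℕ.* k) - ι m * Δ a k ∈B A ℚ.+ (e ℚ.+ e)
      Δ-multiple a k k∈ zero = ≈⇒∈B (trans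
        (x≈y⇒x-y≈0 (fun-cong f {a +ᶻ ℕ→ℤₚ 0} {a} (+-identityʳ (val a)))) (sym (zeroˡ _)))
      Δ-multiple a k k∈ (suc m) = ∈B-≈
        (solve 5 (λ x y z w i → ((x :- y) :- (z :- w)) :+ ((y :- w) :- i :* (z :- w))
            := (x :- w) :- (:1 :+ i) :* (z :- w)) refl _ _ _ _ (ι m))
        (∈B-+ (smooth f {a +ᶻ ℕ→ℤₚ (k ℕ.+ m ℕ.* k)} {a +ᶻ ℕ→ℤₚ (m ℕ.* k)} {a +ᶻ ℕ→ℤₚ k} {a}
                (trans x-y≈k (solve 2 (λ k a → k := (a :+ k) :- a) refl (ι k) (val a)))
                (∈B-≈ (sym x-y≈k) k∈)
                (∈B-≈ (sym x-z≈mk) (∈B-≈ (sym (ι-* m k)) (∈B-Unit* (ι∈B m) k∈))))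
              (Δ-multiple a k k∈ m))
        where
        x-y≈k : (val a + ι (k ℕ.+ m ℕ.* k)) - (val a + ι (m ℕ.* k)) ≈ ι k
        x-y≈k = trans (+-congʳ (+-congˡ (ι-+ k (m ℕ.* k)))) (solve 3 (λ a b c → (a :+ (b :+ c)) :- (a :+ c) := b) refl _ _ _)
        x-z≈mk : (val a + ι (k ℕ.+ m ℕ.* k)) - (val a + ι k) ≈ ι (m ℕ.* k)
        x-z≈mk = trans (+-congʳ (+-congˡ (ι-+ k (m ℕ.* k)))) (solve 3 (λ a b c → (a :+ (b :+ c)) :- (a :+ b) := c) refl _ _ _)

      p^N≉0 : ∀ N → ι (p ℕ.^ N) ≉ 0#
      p^N≉0 N = ι≉0 (p ℕ.^ N) ⦃ ℕ.m^n≢0 p N ⦃ prime⇒nonZero prime ⦄ ⦄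

      D : ℤₚ → ℕ → Carrier
      D a N = Δ a (p ℕ.^ N) * ι (p ℕ.^ N) ⁻¹

      -- `Δ-multiple` with step pᴺ and p repetitions has error p^(A - 2N); division by pᴺ⁺¹, of
      -- absolute value p^-(N + 1), leaves p^(A + 1 - N).
      D-step : ∀ a N → D a (suc N) - D a N ∈B A ℚ.+ 1ℚ ℚ.+ ν N
      D-step a N = ∈B-≈ (begin
          (Δ a (p ℕ.* P) - ι p * Δ a P) * ι (p ℕ.* P) ⁻¹
            ≈⟨ solve 4 (λ x y z w → (x :- y :* z) :* w := x :* w :- z :* (y :* w)) refl _ _ _ _ ⟩
          Δ a (p ℕ.* P) * ι (p ℕ.* P) ⁻¹ - Δ a P * (ι p * ι (p ℕ.* P) ⁻¹) ≈⟨ +-congˡ (-‿cong (*-congˡ inv)) ⟩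
          D a (suc N) - D a N                                       ∎)
        (∈B-≡ ([a+[n+n]]-[-e+n] 1ℚ A (ν N))
          (∈B-* (Δ-multiple a P (∣∣≡⇒∈B (∣ιp^∣ N)) p) (∣∣≡⇒∈B (∣∣-⁻¹ (∣ιp^∣ (suc N))))))
        where
        P = p ℕ.^ N
        inv : ι p * ι (p ℕ.* P) ⁻¹ ≈ ι P ⁻¹
        inv = inverse-unique (p^N≉0 N) (trans (solve 3 (λ a b c → a :* (b :* c) := (b :* a) :* c) refl _ _ _)
          (trans (*-congʳ (sym (ι-* p P))) (⁻¹-inverse (p^N≉0 (suc N)))))

    opaque
      derivative : ∀ a → ∃ λ L → (D a ⟶ L) × (∀ N → D a N - L ∈B A ℚ.+ 1ℚ ℚ.+ ν N)
      derivative a = geometric -1<0 (A ℚ.+ 1ℚ) (D a) (D-step a)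

    private
      module _ (a : ℤₚ) (L : Carrier) (rate : ∀ N → D a N - L ∈B A ℚ.+ 1ℚ ℚ.+ ν N) where

        Δ-rate : ∀ N → Δ a (p ℕ.^ N) - ι (p ℕ.^ N) * L ∈B ν N ℚ.+ (A ℚ.+ 1ℚ ℚ.+ ν N)
        Δ-rate N = ∈B-≈ (begin
            P * (X * P ⁻¹ - L)        ≈⟨ solve 4 (λ p x i l → p :* (x :* i :- l) := (p :* i) :* x :- p :* l) refl P X (P ⁻¹) L ⟩
            (P * P ⁻¹) * X - P * L    ≈⟨ +-congʳ (*-congʳ (⁻¹-inverse (p^N≉0 N))) ⟩
            1# * X - P * L            ≈⟨ +-congʳ (*-identityˡ X) ⟩
            X - P * L                 ∎)
          (∈B-* (∣∣≡⇒∈B (∣ιp^∣ N)) (rate N))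
          where
          P = ι (p ℕ.^ N)
          X = Δ a (p ℕ.^ N)

        module _ (R s : ℚ) (L∈ : L ∈B R) (x y : ℤₚ) (v t : ℚ) (t≡ : A ℚ.+ 1ℚ ℚ.+ t ≡ s)
                 (∣x-y∣ : ∣ val x - val y ∣ ≡ p^ v) (v≤t : v ℚ.≤ t) (y-a∈ : val y - val a ∈B t) where

          -- The precision to which x - y is replaced by an integer n. The bound v - 1 excludes n =
          -- 0 and keeps |n| ≤ |x - y|; the other two make the cost of moving x to y + n, and of the
          -- error times L, at most p^(s + v).
          w : ℚ
          w = (v ℚ.+ -1ℚ) ℚ.⊓ (((s ℚ.+ v) ℚ.- A) ℚ.⊓ ((s ℚ.+ v) ℚ.- R))

          w≤₁ : w ℚ.≤ v ℚ.+ -1ℚ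
          w≤₁ = ℚ.p⊓q≤p (v ℚ.+ -1ℚ) _
          w≤₂ : A ℚ.+ w ℚ.≤ s ℚ.+ v
          w≤₂ = ≡.subst (A ℚ.+ w ℚ.≤_) (r+[s-r]≡s A (s ℚ.+ v))
                  (ℚ.+-monoʳ-≤ A (ℚ.≤-trans (ℚ.p⊓q≤q (v ℚ.+ -1ℚ) _) (ℚ.p⊓q≤p ((s ℚ.+ v) ℚ.- A) ((s ℚ.+ v) ℚ.- R))))
          w≤₃ : w ℚ.+ R ℚ.≤ s ℚ.+ v
          w≤₃ = ≡.subst (w ℚ.+ R ℚ.≤_) (s-r+r≡s (s ℚ.+ v) R)
                  (ℚ.+-monoˡ-≤ R (ℚ.≤-trans (ℚ.p⊓q≤q (v ℚ.+ -1ℚ) _) (ℚ.p⊓q≤q ((s ℚ.+ v) ℚ.- A) ((s ℚ.+ v) ℚ.- R))))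

          v-1<v : v ℚ.+ -1ℚ ℚ.< v
          v-1<v = ≡.subst (v ℚ.+ -1ℚ ℚ.<_) (ℚ.+-identityʳ v) (ℚ.+-monoʳ-< v -1<0)

          A≤A+1 : A ℚ.≤ A ℚ.+ 1ℚ
          A≤A+1 = ≡.subst (ℚ._≤ A ℚ.+ 1ℚ) (ℚ.+-identityʳ A) (ℚ.+-monoʳ-≤ A 0≤1)

          A+[a+b]≤s+v : ∀ {a b} → a ℚ.≤ t → b ℚ.≤ v → A ℚ.+ (a ℚ.+ b) ℚ.≤ s ℚ.+ v
          A+[a+b]≤s+v a≤t b≤v = ℚ.≤-trans (ℚ.+-mono-≤ A≤A+1 (ℚ.+-mono-≤ a≤t b≤v))
            (ℚ.≤-reflexive (≡.trans (≡.sym (ℚ.+-assoc (A ℚ.+ 1ℚ) t v)) (≡.cong (ℚ._+ v) t≡)))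

          -- Five replacements, each costing at most p^(s + v): x by y + n; the increment over n = m
          -- P by m increments over P; the base point y by a; the increment over P by P L; and
          -- finally m P by x - y.
          expand : ∀ n → (val x - val y) - ι n ∈B w → (F x - F y) - (val x - val y) * L ∈B s ℚ.+ v
          expand n h-n∈ with p-part n
          -- n = 0 would give |x - y| ≤ p^(v - 1), against |x - y| = pᵛ.
          ... | inj₁ ≡.refl = contradiction
                  (ℚ.≤-trans (∈B⇒≤ ∣x-y∣ (∈B-≈ (solve 1 (λ h → h :- con (0 , 0) := h) refl _) h-n∈)) w≤₁) (<⇒≱ v-1<v)
          ... | inj₂ (N , m , ≡.refl , p∤m) = ∈B-≈
                (solve 10 (λ fx fy fyn yP aP fa m P l h →
                    ((((fx :- fyn) :+ ((fyn :- fy) :- m :* (yP :- fy))) :+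
                      m :* ((yP :- fy) :- (aP :- fa))) :+ m :* ((aP :- fa) :- P :* l)) :+ :- (h :- m :* P) :* l
                    := (fx :- fy) :- h :* l) refl
                  (F x) (F y) (F (y +ᶻ ℕ→ℤₚ n)) (F (y +ᶻ ℕ→ℤₚ P)) (F (a +ᶻ ℕ→ℤₚ P)) (F a) (ι m) (ι P) L (val x - val y))
                (∈B-+ (∈B-+ (∈B-+ (∈B-+
                  (∈B-mono w≤₂ (lipschitz f {x} {y +ᶻ ℕ→ℤₚ n} (∈B-≈ (solve 3 (λ x y n → (x :- y) :- n := x :- (y :+ n)) refl _ _ _) h-n∈)))
                  (∈B-mono (A+[a+b]≤s+v (ℚ.≤-trans ν≤v v≤t) ν≤v) (Δ-multiple y P (∣∣≡⇒∈B (∣ιp^∣ N)) m)))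
                  (∈B-Unit* (ι∈B m) (∈B-mono (≡.subst (ℚ._≤ s ℚ.+ v) (≡.cong (A ℚ.+_) (ℚ.+-comm t (ν N))) (A+[a+b]≤s+v ℚ.≤-refl ν≤v))
                    (smooth f {y +ᶻ ℕ→ℤₚ P} {y} {a +ᶻ ℕ→ℤₚ P} {a}
                      (solve 3 (λ y a P → (y :+ P) :- y := (a :+ P) :- a) refl (val y) (val a) (ι P))
                      (∈B-≈ (solve 2 (λ y P → P := (y :+ P) :- y) refl (val y) (ι P)) (∣∣≡⇒∈B (∣ιp^∣ N)))
                      (∈B-≈ (solve 3 (λ y a P → y :- a := (y :+ P) :- (a :+ P)) refl (val y) (val a) (ι P)) y-a∈)))))
                  (∈B-Unit* (ι∈B m) (∈B-mono (≡.subst (ν N ℚ.+ (A ℚ.+ 1ℚ ℚ.+ ν N) ℚ.≤_)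
                      (≡.trans (≡.cong (v ℚ.+_) t≡) (ℚ.+-comm v s))
                      (ℚ.+-mono-≤ ν≤v (ℚ.+-monoʳ-≤ (A ℚ.+ 1ℚ) (ℚ.≤-trans ν≤v v≤t)))) (Δ-rate N))))
                  (∈B-mono w≤₃ (∈B-* (∈B-neg (∈B-≈ (+-congˡ (-‿cong (ι-* m P))) h-n∈)) L∈)))
            where
            P = p ℕ.^ N

            n∈ : ι (m ℕ.* P) ∈B v
            n∈ = ∈B-≈ (solve 2 (λ a b → a :- (a :- b) := b) refl _ _)
                   (∈B-- (∣∣≡⇒∈B ∣x-y∣) (∈B-mono (ℚ.≤-trans w≤₁ (ℚ.<⇒≤ v-1<v)) h-n∈))

            ν≤v : ν N ℚ.≤ v
            ν≤v = ∈B⇒≤ (p-part-∣∣ m N p∤m) n∈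

          quotient : (F x - F y) * (val x - val y) ⁻¹ - L ∈B s
          quotient = ∈B-≈ (begin
              ((F x - F y) - h * L) * h ⁻¹
                ≈⟨ solve 4 (λ a h l i → (a :- h :* l) :* i := a :* i :- l :* (h :* i)) refl (F x - F y) h L (h ⁻¹) ⟩
              (F x - F y) * h ⁻¹ - L * (h * h ⁻¹)     ≈⟨ +-congˡ (-‿cong (trans (*-congˡ (⁻¹-inverse h≉0)) (*-identityʳ L))) ⟩
              (F x - F y) * h ⁻¹ - L                  ∎)
            (∈B-≡ (s+v-v s v) (∈B-* (let n , h-n = approx (x +ᶻ -ᶻ y) w in expand n h-n) (∣∣≡⇒∈B (∣∣-⁻¹ ∣x-y∣))))
            where
            h = val x - val y
            h≉0 : h ≉ 0#
            h≉0 h≈0 = contradiction (≡.trans (≡.sym ∣x-y∣) (∣∣≡𝟎 h≈0)) λ ()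
            s+v-v : ∀ s v → s ℚ.+ v ℚ.- v ≡ s
            s+v-v s v = ≡.trans (ℚ.+-assoc s v (ℚ.- v)) (≡.trans (≡.cong (s ℚ.+_) (ℚ.+-inverseʳ v)) (ℚ.+-identityʳ s))

    differentiable : UniformlyDifferentiable F
    -- The radius s - (A + 1) repays the factor p^(A + 1) in the rate of convergence to the
    -- derivative; |x - y| stays within it by the ultrametric inequality.
    differentiable a = L , λ s → s ℚ.- (A ℚ.+ 1ℚ) , λ x y x≉y x-a∈ y-a∈ → main s x y x≉y x-a∈ y-a∈ (∣∣? (val x - val y))
      where
      L = proj₁ (derivative a)
      main : ∀ s x y → val x ≉ val y → val x - val a ∈B s ℚ.- (A ℚ.+ 1ℚ) → val y - val a ∈B s ℚ.- (A ℚ.+ 1ℚ) →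
             (val x - val y ≈ 0# ⊎ ∃ λ v → ∣ val x - val y ∣ ≡ p^ v) →
             (F x - F y) * (val x - val y) ⁻¹ - L ∈B s
      main s x y x≉y x-a∈ y-a∈ (inj₁ x-y≈0) = contradiction (x-y≈0⇒x≈y x-y≈0) x≉y
      main s x y x≉y x-a∈ y-a∈ (inj₂ (v , eq)) = quotient a L (proj₂ (proj₂ (derivative a)))
        (proj₁ (bound L)) s (proj₂ (bound L)) x y v (s ℚ.- (A ℚ.+ 1ℚ)) (r+[s-r]≡s (A ℚ.+ 1ℚ) s) eq
        (∈B⇒≤ eq (∈B-trans x-a∈ (∈B-swap y-a∈))) y-a∈

-- A factorial identity and parity.

r!*C*n! : ∀ n r → r ! ℕ.* ((n ℕ.+ r) C r) ℕ.* n ! ≡ (n ℕ.+ r) !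
r!*C*n! n r = begin
  r ! ℕ.* ((n ℕ.+ r) C r) ℕ.* n !              ≡⟨ rearrange (r !) ((n ℕ.+ r) C r) (n !) ⟩
  r ! ℕ.* n ! ℕ.* ((n ℕ.+ r) C r)              ≡⟨ ≡.cong (λ m → r ! ℕ.* m ! ℕ.* ((n ℕ.+ r) C r)) (ℕ.m+n∸n≡m n r) ⟨
  r ! ℕ.* k ! ℕ.* ((n ℕ.+ r) C r)              ≡⟨ ≡.cong (r ! ℕ.* k ! ℕ.*_) (nCk≡n!/k![n-k]! r≤n+r) ⟩
  r ! ℕ.* k ! ℕ.* ((n ℕ.+ r) ! ℕ./ (r ! ℕ.* k !)) ≡⟨ ℕ.m*[n/m]≡n (k![n∸k]!∣n! r≤n+r) ⟩
  (n ℕ.+ r) !                                  ∎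
  where
  open ≡.≡-Reasoning
  k : ℕ
  k = n ℕ.+ r ℕ.∸ r
  r≤n+r : r ℕ.≤ n ℕ.+ r
  r≤n+r = ℕ.m≤n+m r n
  instance
    nonZero : NonZero (r ! ℕ.* k !)
    nonZero = r ℕ.!* k !≢0
  rearrange : ∀ a b c → a ℕ.* b ℕ.* c ≡ a ℕ.* c ℕ.* b
  rearrange a b c = ≡.trans (ℕ.*-assoc a b c) (≡.trans (≡.cong (a ℕ.*_) (ℕ.*-comm b c)) (≡.sym (ℕ.*-assoc a c b)))

even∨odd : ∀ n → 2 ∣ n ⊎ ∃ λ k → n ≡ suc (k ℕ.* 2)
even∨odd zero = inj₁ (divides 0 ≡.refl)
even∨odd (suc n) with even∨odd n
... | inj₁ (divides k ≡.refl) = inj₂ (k , ≡.refl)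
... | inj₂ (k , ≡.refl)       = inj₁ (divides (suc k) ≡.refl)

-- Riemann sums and iterated integrals.

module Integral {p c ℓ} (prime : Prime p) (odd : ¬ 2 ∣ p) (ℂₚ : ComplexPAdics p c ℓ) where
  open ComplexPAdics ℂₚ
  open Smooth prime ℂₚ public
  open Integration ℂₚ
  open Algebra.Properties.Semiring.Exp semiring using (^-homo-*; ^-assocʳ; ^-congˡ; ^-congʳ)
  open import Relation.Binary.Reasoning.Setoid setoid
  open K

  Odd : ℕ → Set (c ⊔ ℓ)
  Odd n = ∀ x → (- x) ^ n ≈ - (x ^ n)

  suc[k*2]-Odd : ∀ k → Odd (suc (k ℕ.* 2))
  suc[k*2]-Odd zero    x = solve 1 (λ x → :- x :* :1 := :- (x :* :1)) refl x
  suc[k*2]-Odd (suc k) x = trans (*-congˡ (*-congˡ (suc[k*2]-Odd k x)))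
    (solve 2 (λ x y → :- x :* (:- x :* :- y) := :- (x :* (x :* y))) refl x (x ^ suc (k ℕ.* 2)))

  Odd-* : ∀ {m n} → Odd m → Odd n → Odd (m ℕ.* n)
  Odd-* {m} {n} om on x = begin
    (- x) ^ (m ℕ.* n)   ≈⟨ ^-assocʳ (- x) m n ⟨
    ((- x) ^ m) ^ n     ≈⟨ ^-congˡ n (om x) ⟩
    (- (x ^ m)) ^ n     ≈⟨ on (x ^ m) ⟩
    - ((x ^ m) ^ n)     ≈⟨ -‿cong (^-assocʳ x m n) ⟩
    - (x ^ (m ℕ.* n))   ∎

  p-Odd : Odd p
  p-Odd with even∨odd p
  ... | inj₁ 2∣p       = contradiction 2∣p odd
  ... | inj₂ (k , eq)  = ≡.subst Odd (≡.sym eq) (suc[k*2]-Odd k)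

  p^N-Odd : ∀ N → Odd (p ℕ.^ N)
  p^N-Odd zero    = suc[k*2]-Odd 0
  p^N-Odd (suc N) = Odd-* {p} {p ℕ.^ N} p-Odd (p^N-Odd N)

  Unit-2 : Unit (1# + 1#)
  Unit-2 = Unit-≈ (+-congˡ ι-1) (p∤⇒Unit {2} λ p∣2 →
    odd (≡.subst (2 ∣_) (ℕ.≤-antisym (ℕ.nonTrivial⇒n>1 p ⦃ prime⇒nonTrivial prime ⦄) (∣⇒≤ p∣2)) (divides 1 ≡.refl)))

  module _ (q : Carrier) {δ} (δ<0 : δ ℚ.< 0ℚ) (q-1∈ : q - 1# ∈B δ) where

    private
      q∈B0 : q ∈B 0ℚ
      q∈B0 = Power.u∈B0 q δ<0 q-1∈

      -- As 2 + (qⁿ - 1) it is a unit plus an element of absolute value below 1. The normalising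
      -- factors of the Riemann sums therefore stay in the unit ball.
      Unit-1+q^ : ∀ n → Unit (1# + q ^ n)
      Unit-1+q^ n = Unit-≈ (solve 1 (λ x → (:1 :+ :1) :+ (x :- :1) := :1 :+ x) refl (q ^ n))
        (Unit-+ Unit-2 δ<0 (^-1∈B q∈B0 q-1∈ n))

      W : ℕ → Carrier
      W N = (1# + q ^ (p ℕ.^ N)) ⁻¹

      W∈B0 : ∀ N → W N ∈B 0ℚ
      W∈B0 N = ∣∣≡⇒∈B (∣∣-⁻¹ (Unit-1+q^ (p ℕ.^ N)))

      1+q∈B0 : 1# + q ∈B 0ℚ
      1+q∈B0 = ∈B-+ (Unit⇒∈B Unit-1) q∈B0

      term : (ℤₚ → Carrier) → ℕ → Carrier
      term f k = f (ℕ→ℤₚ k) * (- q) ^ k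

      -q^∈B0 : ∀ k → (- q) ^ k ∈B 0ℚ
      -q^∈B0 = ^∈B0 (∈B-neg q∈B0)

    riemannSum∈B : ∀ {f s} → (∀ x → f x ∈B s) → ∀ N → riemannSum q f N ∈B s
    riemannSum∈B {f} f∈ N = ∈B-Unit* (∈B-Unit* 1+q∈B0 (W∈B0 N))
      (∑∈B {term f} (λ k → ∈B-*Unit (f∈ (ℕ→ℤₚ k)) (-q^∈B0 k)) (p ℕ.^ N))

    riemannSum-- : ∀ f g N → riemannSum q f N - riemannSum q g N ≈ riemannSum q (λ x → f x - g x) N
    riemannSum-- f g N = begin
      U * ∑ (term f) P - U * ∑ (term g) P       ≈⟨ solve 3 (λ u a b → u :* a :- u :* b := u :* (a :- b)) refl _ _ _ ⟩
      U * (∑ (term f) P - ∑ (term g) P)         ≈⟨ *-congˡ (∑-- (term f) (term g) P) ⟩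
      U * ∑ (λ k → term f k - term g k) P
        ≈⟨ *-congˡ (∑-cong {λ k → term f k - term g k} {term (λ x → f x - g x)} (λ k → solve 3 (λ a b c → a :* c :- b :* c
              := (a :- b) :* c) refl _ _ _) P) ⟩
      U * ∑ (term (λ x → f x - g x)) P          ∎
      where
      P = p ℕ.^ N
      U = (1# + q) * W N

    riemannSum-scale : ∀ {f g} κ → (∀ x → f x ≈ κ * g x) → ∀ N → riemannSum q f N ≈ κ * riemannSum q g N
    riemannSum-scale {f} {g} κ f≈κg N = begin
      U * ∑ (term f) P
        ≈⟨ *-congˡ (∑-cong {term f} {λ k → κ * term g k} (λ k → trans (*-congʳ (f≈κg (ℕ→ℤₚ k))) (*-assoc _ _ _)) P) ⟩
      U * ∑ (λ k → κ * term g k) P      ≈⟨ *-congˡ (∑-*ˡ κ (term g) P) ⟨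
      U * (κ * ∑ (term g) P)            ≈⟨ solve 3 (λ u k s → u :* (k :* s) := k :* (u :* s)) refl _ _ _ ⟩
      κ * (U * ∑ (term g) P)            ∎
      where
      P = p ℕ.^ N
      U = (1# + q) * W N

    module _ (f : 𝒟) where

      private
        F = fun f
        S = λ N → ∑ (term F) (p ℕ.^ N)

        -- Write k < pᴺ⁺¹ as k = i P + x.  Replacing f(k) by f(x) costs O(p⁻ᴺ) and turns the
        -- sum S (suc N) into V * S N; the weights match because p is odd.

        module Step (N : ℕ) where
          P = p ℕ.^ N
          Q = q ^ P
          V = ∑ ((- Q) ^_) p

          Q^p : Q ^ p ≈ q ^ (p ℕ.* P)
          Q^p = trans (^-assocʳ q P p) (^-congʳ q (ℕ.*-comm P p))

          -- The geometric sum at -Q; the sign on the right comes from its odd length p.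
          [1+Q]V : (1# + Q) * V ≈ 1# + Q ^ p
          [1+Q]V = begin
            (1# + Q) * V              ≈⟨ solve 2 (λ x v → (:1 :+ x) :* v := :- ((:- x :- :1) :* v)) refl Q V ⟩
            - ((- Q - 1#) * V)        ≈⟨ -‿cong (^-1-factor (- Q) p) ⟨
            - ((- Q) ^ p - 1#)        ≈⟨ -‿cong (+-congʳ (p-Odd Q)) ⟩
            - (- (Q ^ p) - 1#)        ≈⟨ solve 1 (λ x → :- (:- x :- :1) := :1 :+ x) refl (Q ^ p) ⟩
            1# + Q ^ p                ∎

          -- Consecutive normalising factors differ exactly by V, so in `R-step` the main term
          -- `V * S N` reproduces the previous Riemann sum and only the block errors remain.
          WV : W (suc N) * V ≈ W N
          WV = inverse-unique (Unit⇒≉0 (Unit-1+q^ P)) (begin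
            (1# + Q) * (W (suc N) * V)          ≈⟨ solve 3 (λ a b c → a :* (b :* c) := (a :* c) :* b) refl _ _ _ ⟩
            ((1# + Q) * V) * W (suc N)          ≈⟨ *-congʳ (trans [1+Q]V (+-congˡ Q^p)) ⟩
            (1# + q ^ (p ℕ.* P)) * W (suc N)    ≈⟨ ⁻¹-inverse (Unit⇒≉0 (Unit-1+q^ (p ℕ.* P))) ⟩
            1#                                  ∎)

          -q^ : ∀ i x → (- q) ^ (i ℕ.* P ℕ.+ x) ≈ (- Q) ^ i * (- q) ^ x
          -q^ i x = begin
            (- q) ^ (i ℕ.* P ℕ.+ x)             ≈⟨ ^-homo-* (- q) (i ℕ.* P) x ⟩
            (- q) ^ (i ℕ.* P) * (- q) ^ x       ≈⟨ *-congʳ (^-congʳ (- q) (ℕ.*-comm i P)) ⟩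
            (- q) ^ (P ℕ.* i) * (- q) ^ x       ≈⟨ *-congʳ (^-assocʳ (- q) P i) ⟨
            ((- q) ^ P) ^ i * (- q) ^ x         ≈⟨ *-congʳ (^-congˡ i (p^N-Odd N q)) ⟩
            (- Q) ^ i * (- q) ^ x               ∎

          block : ℕ → ℕ → Carrier
          block i x = term F (i ℕ.* P ℕ.+ x) - (- Q) ^ i * term F x

          block∈B : ∀ i x → block i x ∈B size f ℚ.+ N ·ℚ -1ℚ
          block∈B i x = ∈B-≈ (sym (begin
              F (ℕ→ℤₚ (i ℕ.* P ℕ.+ x)) * (- q) ^ (i ℕ.* P ℕ.+ x) - (- Q) ^ i * term F x
                ≈⟨ +-congʳ (*-congˡ (-q^ i x)) ⟩
              F (ℕ→ℤₚ (i ℕ.* P ℕ.+ x)) * ((- Q) ^ i * (- q) ^ x) - (- Q) ^ i * term F x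
                ≈⟨ solve 4 (λ a b c d → a :* (b :* c) :- b :* (d :* c) := (a :- d) :* (b :* c)) refl _ _ _ _ ⟩
              (F (ℕ→ℤₚ (i ℕ.* P ℕ.+ x)) - F (ℕ→ℤₚ x)) * ((- Q) ^ i * (- q) ^ x) ∎))
            (∈B-*Unit (lipschitz f {ℕ→ℤₚ (i ℕ.* P ℕ.+ x)} {ℕ→ℤₚ x} (∈B-≈ (sym (begin
                ι (i ℕ.* P ℕ.+ x) - ι x        ≈⟨ +-congʳ (trans (ι-+ (i ℕ.* P) x) (+-congʳ (ι-* i P))) ⟩
                (ι i * ι P + ι x) - ι x        ≈⟨ solve 2 (λ a b → (a :+ b) :- b := a) refl _ _ ⟩
                ι i * ι P                      ∎))
                (∈B-Unit* (ι∈B i) (∣∣≡⇒∈B (∣ιp^∣ N)))))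
              (∈B-Unit* (^∈B0 (∈B-neg (^∈B0 q∈B0 P)) i) (-q^∈B0 x)))

          S-step : S (suc N) - V * S N ∈B size f ℚ.+ N ·ℚ -1ℚ
          S-step = ∈B-≈ (sym (begin
              ∑ (term F) (p ℕ.* P) - V * S N
                ≈⟨ +-cong (∑-blocks (term F) p P) (-‿cong (∑-*ʳ (S N) ((- Q) ^_) p)) ⟩
              ∑ (λ i → ∑ (λ x → term F (i ℕ.* P ℕ.+ x)) P) p - ∑ (λ i → (- Q) ^ i * S N) p
                ≈⟨ ∑-- (λ i → ∑ (λ x → term F (i ℕ.* P ℕ.+ x)) P) (λ i → (- Q) ^ i * S N) p ⟩
              ∑ (λ i → ∑ (λ x → term F (i ℕ.* P ℕ.+ x)) P - (- Q) ^ i * S N) p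
                ≈⟨ ∑-cong {λ i → ∑ (λ x → term F (i ℕ.* P ℕ.+ x)) P - (- Q) ^ i * S N} {λ i → ∑ (block i) P}
                   (λ i → trans (+-congˡ (-‿cong (∑-*ˡ ((- Q) ^ i) (term F) P)))
                                (∑-- (λ x → term F (i ℕ.* P ℕ.+ x)) (λ x → (- Q) ^ i * term F x) P)) p ⟩
              ∑ (λ i → ∑ (block i) P) p ∎))
            (∑∈B {λ i → ∑ (block i) P} (λ i → ∑∈B {block i} (block∈B i) P) p)

          R-step : riemannSum q F (suc N) - riemannSum q F N ∈B size f ℚ.+ N ·ℚ -1ℚ
          R-step = ∈B-≈ (begin
              (1# + q) * W (suc N) * (S (suc N) - V * S N)
                ≈⟨ solve 5 (λ a b c d e → a :* b :* (c :- d :* e) := a :* b :* c :- a :* (b :* d) :* e) refl _ _ _ _ _ ⟩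
              (1# + q) * W (suc N) * S (suc N) - (1# + q) * (W (suc N) * V) * S N
                ≈⟨ +-congˡ (-‿cong (*-congʳ (*-congˡ WV))) ⟩
              (1# + q) * W (suc N) * S (suc N) - (1# + q) * W N * S N ∎)
            (∈B-Unit* (∈B-Unit* 1+q∈B0 (W∈B0 (suc N))) S-step)

      opaque
        integral : ∃ λ I → riemannSum q F ⟶ I
        integral = let I , R⟶I , _ = geometric -1<0 (size f) (riemannSum q F) Step.R-step in I , R⟶I

    -- The argument c stands for the sum of the outer variables. `size` is unchanged because the
    -- normalising factor and all weights of a Riemann sum lie in the unit ball.
    ∫ : 𝒟 → 𝒟
    ∫ f = record
      { fun       = λ c → proj₁ (integral (translate c f))
      ; size      = size f
      ; bounded   = λ c → ⟶-∈B (riemannSum∈B (bounded (translate c f))) (lim c)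
      ; lipschitz = λ {x} {y} h → ⟶-∈B
          (λ N → ∈B-≈ (sym (riemannSum-- (F x) (F y) N)) (riemannSum∈B (λ c → lipschitz f {x +ᶻ c} {y +ᶻ c}
            (∈B-≈ (shift (val x) (val y) (val c)) h)) N))
          (⟶-- (lim x) (lim y))
      ; smooth    = λ {x} {y} {z} {w} e h k → ⟶-∈B
          (λ N → ∈B-≈ (sym (trans (+-cong (riemannSum-- (F x) (F y) N) (-‿cong (riemannSum-- (F z) (F w) N)))
                             (riemannSum-- (λ c → F x c - F y c) (λ c → F z c - F w c) N)))
             (riemannSum∈B (λ c → smooth f {x +ᶻ c} {y +ᶻ c} {z +ᶻ c} {w +ᶻ c}
               (trans (sym (shift (val x) (val y) (val c))) (trans e (shift (val z) (val w) (val c))))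
               (∈B-≈ (shift (val x) (val y) (val c)) h) (∈B-≈ (shift (val x) (val z) (val c)) k)) N))
          (⟶-- (⟶-- (lim x) (lim y)) (⟶-- (lim z) (lim w)))
      }
      where
      F : ℤₚ → ℤₚ → Carrier
      F x c = fun f (x +ᶻ c)
      lim : ∀ c → riemannSum q (F c) ⟶ proj₁ (integral (translate c f))
      lim c = proj₂ (integral (translate c f))
      shift : ∀ x y c → x - y ≈ (x + c) - (y + c)
      shift = solve 3 (λ x y c → x :- y := (x :+ c) :- (y :+ c)) refl

    ∫-isIntegral : ∀ f c → IsIntegral q (λ x → fun f (c +ᶻ x)) (fun (∫ f) c)
    ∫-isIntegral f c = record
      { f-cong                  = fun-cong (translate c f)
      ; uniformlyDifferentiable = Derivative.differentiable (translate c f)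
      ; limit                   = proj₂ (integral (translate c f))
      }

    ∫^ : ℕ → 𝒟 → 𝒟
    ∫^ zero    f = f
    ∫^ (suc r) f = ∫ (∫^ r f)

    -- The base point a collects the outer variables fixed so far, so the induction needs it
    -- arbitrary. Quantifying over all z of the right value makes reassociating the sum harmless.
    ∫^-isIteratedIntegral : ∀ r f a {F : Vec ℤₚ r → Carrier → Set (c ⊔ ℓ)} →
      (∀ xs z → val z ≈ val a + total xs → F xs (fun f z)) → IsIteratedIntegral q r F (fun (∫^ r f) a)
    ∫^-isIteratedIntegral zero    f a h = h [] a (sym (+-identityʳ _))
    ∫^-isIteratedIntegral (suc r) f a h = (λ x → fun (∫^ r f) (a +ᶻ x)) ,
      (λ x → ∫^-isIteratedIntegral r f (a +ᶻ x) λ xs z e → h (x ∷ xs) z (trans e (+-assoc _ _ _))) ,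
      ∫-isIntegral (∫^ r f) a

    -- Homogeneity and uniqueness in one induction: inner integrals are proportional, hence so are
    -- the Riemann sums, and limits are unique. No particular construction of the integrals enters,
    -- so it applies to arbitrary given numbers.
    iteratedIntegral-scale : ∀ κ r {F G : Vec ℤₚ r → Carrier → Set (c ⊔ ℓ)} {I J} →
      (∀ xs {y z} → F xs y → G xs z → y ≈ κ * z) →
      IsIteratedIntegral q r F I → IsIteratedIntegral q r G J → I ≈ κ * J
    iteratedIntegral-scale κ zero    h Fy Gz = h [] Fy Gz
    iteratedIntegral-scale κ (suc r) h (f , F , ∫f) (g , G , ∫g) = ⟶-unique (IsIntegral.limit ∫f)
      (⟶-cong (sym ∘ riemannSum-scale κ (λ x → iteratedIntegral-scale κ r (λ xs → h (x ∷ xs)) (F x) (G x)))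
        (⟶-*ˡ κ (IsIntegral.limit ∫g)))

    iteratedIntegral-map : ∀ r {F G : Vec ℤₚ r → Carrier → Set (c ⊔ ℓ)} {I} →
      (∀ xs {y} → F xs y → G xs y) → IsIteratedIntegral q r F I → IsIteratedIntegral q r G I
    iteratedIntegral-map zero    h Fy = h [] Fy
    iteratedIntegral-map (suc r) h (f , F , ∫f) = f , (λ x → iteratedIntegral-map r (λ xs → h (x ∷ xs)) (F x)) , ∫f

  -- Euler and Genocchi numbers.

  module EulerGenocchi (q w : Carrier) (∣1-q∣<1 : ∣ 1# - q ∣ <ᵛ 𝟏) (∣1-w∣<1 : ∣ 1# - w ∣ <ᵛ 𝟏) where

    -- `Power` expects a closed ball of negative exponent. The exponent of |1 - u| itself serves;
    -- for u = 1 any negative one would do.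
    radius : ∀ {u} → ∣ 1# - u ∣ <ᵛ 𝟏 → ∃ λ δ → δ ℚ.< 0ℚ × u - 1# ∈B δ
    radius {u} h = let δ , δ<0 , k = go h in δ , δ<0 , ∈B-swap k
      where
      go : ∀ {v} → v <ᵛ 𝟏 → ∃ λ δ → δ ℚ.< 0ℚ × v ≤ᵛ p^ δ
      go <ᵛ.⊥₋<[ _ ] = -1ℚ , -1<0 , ≤ᵛ.⊥₋≤ _
      go <ᵛ.[ δ<0 ]  = _ , δ<0 , ≤ᵛ.[ ℚ.≤-refl ]

    private
      δq<0 = proj₁ (proj₂ (radius ∣1-q∣<1))
      q-1∈ = proj₂ (proj₂ (radius ∣1-q∣<1))

    module q^ = Power q δq<0 q-1∈
    module w^ = Power w (proj₁ (proj₂ (radius ∣1-w∣<1))) (proj₂ (proj₂ (radius ∣1-w∣<1)))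

    q^ᴰ w^ᴰ q^-ᴰ : 𝒟
    q^ᴰ  = characterᴰ q^.pow q^.κ q^.pow∈B0 (λ {x} {y} {z} → q^.pow-+ {x} {y} {z}) q^.pow-lipschitz
    w^ᴰ  = characterᴰ w^.pow w^.κ w^.pow∈B0 (λ {x} {y} {z} → w^.pow-+ {x} {y} {z}) w^.pow-lipschitz
    q^-ᴰ = characterᴰ (q^.pow ∘ -ᶻ_) q^.κ (q^.pow∈B0 ∘ -ᶻ_)
      (λ {x} {y} {z} e → q^.pow-+ { -ᶻ x} { -ᶻ y} { -ᶻ z}
        (trans (-‿cong e) (solve 2 (λ x y → :- (x :+ y) := :- x :+ :- y) refl (val x) (val y))))
      (λ h h∈ → q^.pow-lipschitz (-ᶻ h) (∈B-neg h∈))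

    -- For q ≠ 1 the inverse of 1 - q may be large, but it enters as a constant factor and so
    -- affects only `size`.
    bracket : ∃ λ (f : 𝒟) → ∀ z {x} → val z ≈ x → IsBracket q x (fun f z)
    bracket with ≈0? (q - 1#)
    ... | yes q-1≈0 = idᴰ , λ _ → q≈1 (x-y≈0⇒x≈y q-1≈0)
    ... | no  q-1≉0 = (constᴰ 1# -ᴰ q^ᴰ) *ᴰ constᴰ ((1# - q) ⁻¹) , λ z e →
      q≉1 (q-1≉0 ∘ x≈y⇒x-y≈0) (q^.pow-isPower z e) refl

    [_]ᴰ : 𝒟
    [_]ᴰ = proj₁ bracket

    isBracket-unique : ∀ {x y y′} → IsBracket q x y → IsBracket q x y′ → y ≈ y′
    isBracket-unique (q≈1 _ h)     (q≈1 _ h′)      = trans h (sym h′)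
    isBracket-unique (q≈1 q≈ _)    (q≉1 q≉ _ _)    = contradiction q≈ q≉
    isBracket-unique (q≉1 q≉ _ _)  (q≈1 q≈ _)      = contradiction q≈ q≉
    isBracket-unique (q≉1 _ qˣ h)  (q≉1 _ qˣ′ h′)  =
      trans h (trans (*-congʳ (+-congˡ (-‿cong (⟶-unique qˣ qˣ′)))) (sym h′))

    0ᶻ : ℤₚ
    0ᶻ = ℕ→ℤₚ 0

    iterated : ∀ r (h : Carrier → Carrier → Carrier → Carrier) (f : 𝒟) →
      (∀ z → fun f z ≈ h (fun q^-ᴰ z) (fun w^ᴰ z) (fun [_]ᴰ z)) →
      IsIteratedIntegral q r (Integrand q w h) (fun (∫^ q δq<0 q-1∈ r f) 0ᶻ)
    iterated r h f f≈h = ∫^-isIteratedIntegral q δq<0 q-1∈ r f 0ᶻ λ xs z e →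
      let e′ = trans e (+-identityˡ _) in
      fun q^-ᴰ z , fun w^ᴰ z , fun [_]ᴰ z ,
      q^.pow-isPower (-ᶻ z) (-‿cong e′) , w^.pow-isPower z e′ , proj₂ bracket z e′ , f≈h z

    eulerIntegrand : ℕ → 𝒟
    eulerIntegrand n = w^ᴰ *ᴰ [_]ᴰ ^ᴰ n *ᴰ q^-ᴰ

    euler : ∀ r → ∃ λ E → IsEulerNumbers q w r E
    euler r = _ , λ n → iterated r _ (eulerIntegrand n) λ z → *-congʳ (*-congˡ (fun-^ᴰ [_]ᴰ n z))

    ⁻¹! : ∀ n → ι (n !) * ι (n !) ⁻¹ ≈ 1#
    ⁻¹! n = ι⁻¹ (n !) ⦃ n ℕ.!≢0 ⦄

    genocchi : ∀ r → ∃ λ G → IsGenocchiNumbers q w r G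
    -- The defining identity egf G = tʳ S solved for G: the n-th coefficient of tʳ S times n!, where
    -- S integrates the exponential coefficientwise.
    genocchi r = (λ n → ι (n !) * (t^ r · S) n) , S ,
      (λ n → iterated r _ (F n) λ z → begin
        fun w^ᴰ z * fun ([_]ᴰ ^ᴰ n) z * fun q^-ᴰ z * ι (n !) ⁻¹
          ≈⟨ solve 4 (λ w b q i → w :* b :* q :* i := q :* w :* (b :* i)) refl _ _ _ _ ⟩
        fun q^-ᴰ z * fun w^ᴰ z * (fun ([_]ᴰ ^ᴰ n) z * ι (n !) ⁻¹)    ≈⟨ *-congˡ (*-congʳ (fun-^ᴰ [_]ᴰ n z)) ⟩
        fun q^-ᴰ z * fun w^ᴰ z * (fun [_]ᴰ z ^ n * ι (n !) ⁻¹)       ∎) ,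
      λ n → begin
        ι (n !) * (t^ r · S) n * ι (n !) ⁻¹     ≈⟨ solve 3 (λ a b c → a :* b :* c := a :* c :* b) refl _ _ _ ⟩
        ι (n !) * ι (n !) ⁻¹ * (t^ r · S) n     ≈⟨ *-congʳ (⁻¹! n) ⟩
        1# * (t^ r · S) n                       ≈⟨ *-identityˡ _ ⟩
        (t^ r · S) n                            ∎
      where
      F : ℕ → 𝒟
      F n = eulerIntegrand n *ᴰ constᴰ (ι (n !) ⁻¹)
      S : Series
      S n = fun (∫^ q δq<0 q-1∈ r (F n)) 0ᶻ

    t^·-≥ : ∀ r S n → (t^ r · S) (r ℕ.+ n) ≡ S n
    t^·-≥ zero    S n = ≡.refl
    t^·-≥ (suc r) S n = t^·-≥ r S n

    t^·-< : ∀ {r} S {m} → m ℕ.< r → (t^ r · S) m ≈ 0#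
    t^·-< {suc r} S {zero}  _           = refl
    t^·-< {suc r} S {suc m} (ℕ.s≤s m<r) = t^·-< S m<r

    module _ (r : ℕ) {E G : ℕ → Carrier} (isE : IsEulerNumbers q w r E) (isG : IsGenocchiNumbers q w r G) where

      private
        S = proj₁ isG

        -- Both families bring their own witnesses for q^(-s), wˢ and [s]; uniqueness of limits
        -- identifies these, after which the integrands differ by the factor 1/n!.
        S≈E/n! : ∀ n → S n ≈ ι (n !) ⁻¹ * E n
        S≈E/n! n = iteratedIntegral-scale q δq<0 q-1∈ (ι (n !) ⁻¹) r
          (λ xs (a , b , d , a! , b! , d! , y≈) (a′ , b′ , d′ , a′! , b′! , d′! , z≈) → trans y≈ (trans
            (*-cong (*-cong (⟶-unique a! a′!) (⟶-unique b! b′!)) (*-congʳ (^-congˡ n (isBracket-unique d! d′!))))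
            (trans (solve 4 (λ a b d i → a :* b :* (d :* i) := i :* (b :* d :* a)) refl a′ b′ (d′ ^ n) _) (*-congˡ (sym z≈)))))
          (proj₁ (proj₂ isG) n) (isE n)
  
        egf-G : ∀ n → G (n ℕ.+ r) * ι ((n ℕ.+ r) !) ⁻¹ ≈ ι (n !) ⁻¹ * E n
        egf-G n = trans (proj₂ (proj₂ isG) (n ℕ.+ r)) (trans (reflexive
          (≡.trans (≡.cong (t^ r · S) (ℕ.+-comm n r)) (t^·-≥ r S n))) (S≈E/n! n))

      -- The coefficient of t^(n + r) gives G(n + r)/(n + r)! = E(n)/n!, and the remaining factor (n
      -- + r)!/n! is r! times the binomial coefficient.
      genocchi≈euler : ∀ n → G (n ℕ.+ r) * ι (r ! ℕ.* ((n ℕ.+ r) C r)) ⁻¹ ≈ E n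
      genocchi≈euler n = begin
        G (n ℕ.+ r) * X ⁻¹                          ≈⟨ *-congˡ X⁻¹ ⟨
        G (n ℕ.+ r) * (Y * Z ⁻¹)                    ≈⟨ solve 3 (λ g y z → g :* (y :* z) := y :* (g :* z)) refl _ _ _ ⟩
        Y * (G (n ℕ.+ r) * Z ⁻¹)                    ≈⟨ *-congˡ (egf-G n) ⟩
        Y * (Y ⁻¹ * E n)                            ≈⟨ *-assoc _ _ _ ⟨
        Y * Y ⁻¹ * E n                              ≈⟨ *-congʳ (⁻¹! n) ⟩
        1# * E n                                    ≈⟨ *-identityˡ _ ⟩
        E n                                         ∎
        where
        X = ι (r ! ℕ.* ((n ℕ.+ r) C r))
        Y = ι (n !)
        Z = ι ((n ℕ.+ r) !)
        XY≈Z : X * Y ≈ Z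
        XY≈Z = trans (sym (ι-* (r ! ℕ.* ((n ℕ.+ r) C r)) (n !))) (ι-cong (r!*C*n! n r))
        X≉0 : X ≉ 0#
        X≉0 X≈0 = ι≉0 ((n ℕ.+ r) !) ⦃ (n ℕ.+ r) ℕ.!≢0 ⦄ (trans (sym XY≈Z) (trans (*-congʳ X≈0) (zeroˡ Y)))
        X⁻¹ : Y * Z ⁻¹ ≈ X ⁻¹
        X⁻¹ = inverse-unique X≉0 (trans (sym (*-assoc X Y (Z ⁻¹))) (trans (*-congʳ XY≈Z) (⁻¹! (n ℕ.+ r))))

      genocchi≈0 : ∀ m → m ℕ.< r → G m ≈ 0#
      genocchi≈0 m m<r = begin
        G m                                  ≈⟨ *-identityˡ _ ⟨
        1# * G m                             ≈⟨ *-congʳ (⁻¹! m) ⟨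
        ι (m !) * ι (m !) ⁻¹ * G m           ≈⟨ solve 3 (λ a b g → a :* b :* g := a :* (g :* b)) refl _ _ _ ⟩
        ι (m !) * (G m * ι (m !) ⁻¹)         ≈⟨ *-congˡ (trans (proj₂ (proj₂ isG) m) (t^·-< S m<r)) ⟩
        ι (m !) * 0#                         ≈⟨ zeroʳ _ ⟩
        0#                                   ∎

    euler-integral : ∀ r {I} n →
      IsIteratedIntegral q r (Integrand q w λ q⁻ˢ wˢ [s] → wˢ * [s] ^ n * q⁻ˢ) I →
      IsIteratedIntegral q r (Integrand q w λ q⁻ˢ wˢ [s] → q⁻ˢ * wˢ * [s] ^ n) I
    euler-integral r n = iteratedIntegral-map q δq<0 q-1∈ r λ xs (a , b , d , a! , b! , d! , y≈) →
      a , b , d , a! , b! , d! , trans y≈ (solve 3 (λ a b d → b :* d :* a := a :* b :* d) refl a b (d ^ n))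

-- Both families of numbers are described by relations, so their existence is asserted first; the
-- identities then hold for any sequences satisfying the relations and are not vacuous.
theorem4 : ∀ {c ℓ} (p : ℕ) → Prime p → ¬ (2 ∣ p) →
    (ℂₚ : ComplexPAdics p c ℓ) →
    let open ComplexPAdics ℂₚ
        open Integration ℂₚ
    in
    (q w : Carrier) → ∣ 1# - q ∣ <ᵛ 𝟏 → ∣ 1# - w ∣ <ᵛ 𝟏 →
    (r : ℕ) → r ℕ.≥ 1 →
    (∃ λ E → IsEulerNumbers q w r E) ×
    (∃ λ G → IsGenocchiNumbers q w r G) ×
    (∀ E G → IsEulerNumbers q w r E → IsGenocchiNumbers q w r G →
      (∀ n → ∃ λ I →
        IsIteratedIntegral q r (Integrand q w λ q⁻ˢ wˢ [s] → q⁻ˢ * wˢ * [s] ^ n) I ×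
        G (n ℕ.+ r) * ι (r ! ℕ.* ((n ℕ.+ r) C r)) ⁻¹ ≈ I ×
        I ≈ E n) ×
      (∀ m → m ℕ.< r → G m ≈ 0#))
theorem4 p p-prime odd ℂₚ q w ∣1-q∣<1 ∣1-w∣<1 r _ =
  euler r , genocchi r , λ E G isE isG →
    -- The integral in the middle is `E n` itself, since its integrand is that of the Euler numbers
    -- with the factors reordered.
    (λ n → E n , euler-integral r n (isE n) , genocchi≈euler r isE isG n , refl) ,
    genocchi≈0 r isE isG
  where
  open ComplexPAdics ℂₚ using (refl)
  open Integral.EulerGenocchi p-prime odd ℂₚ q w ∣1-q∣<1 ∣1-w∣<1
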